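{- Let $p$ be a prime, $l\ge1$, and let $s_1,\ldots,s_l$ be positive integers. Put $w=\sum_{i=1}^l s_i$ and $I=\{s_1,\,s_1+s_2,\,\dots,\,s_1+s_2+\dots+s_{l-1}\}$ (so $I=\emptyset$ if $l=1$). Then $$H_{p-1}^q(s_1,\ldots,s_l)\equiv (-1)^l\sum_{\substack{1\leq j_1\leq j_2\leq\dots\leq j_w\leq p-1\\ j_i<j_{i+1},\; i\in I}}\ \prod_{i=1}^w\frac{q^{j_i}}{[j_i]_q} \pmod{[p]_q}.$$
   Context: Here $q$ is an indeterminate and $[n]_q=\frac{1-q^n}{1-q}=1+q+\cdots+q^{n-1}$. For positive integers $s_1,\dots,s_l$, $$H_n^q(s_1,\ldots,s_l)=\sum_{1\le k_1<\cdots<k_l\le n}\prod_{i=1}^l\frac{q^{(s_i-1)k_i}}{[k_i]_q^{s_i}}$$ (which is $0$ if $n<l$). In the sum over $j_1,\dots,j_w$ the inequality $j_i\le j_{i+1}$ is required for all $1\le i\le w-1$, and it is required to be strict for $i\in I$. For a prime $p$ and rational functions $A,B$ in $q$, $A\equiv B\pmod{[p]_q}$ means $A-B=f/g$ with $f,g$ polynomials in $q$ with integer coefficients, $g$ coprime to $[p]_q$ in $\mathbb{Q}[q]$, and $[p]_q\mid f$ ($[p]_q$ is the $p$th cyclotomic polynomial, irreducible over $\mathbb{Q}$). -}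

module Defs where

open import Algebra.Bundles.Raw using (RawRing)
import Algebra.Definitions.RawSemiring as RawSemiringDefs
open import Data.Fin.Base as Fin using (Fin; toℕ)
open import Data.Fin.Properties as Fin using (all?)
open import Data.Integer.Base as ℤ using (ℤ; 0ℤ; 1ℤ)
import Data.Integer.Properties as ℤ
open import Data.List.Base as List
  using (List; []; _∷_; allFin; applyUpTo; cartesianProductWith; filter; foldr; replicate)
open import Data.List.Membership.Propositional using (_∈_)
open import Data.Nat.Base as ℕ using (ℕ; zero; suc; pred; _∸_; s≤s)
open import Data.Nat.ListAction using (sum)
import Data.Nat.Properties as ℕ
open import Data.List.Membership.DecPropositional ℕ._≟_ using (_∈?_)
open import Data.Product.Base using (∃; _×_; _,_)
open import Data.Rational.Base as ℚ using (ℚ)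
open import Data.Sum.Base using (_⊎_; inj₁; inj₂; [_,_]′)
open import Data.Vec.Base as Vec using (Vec; []; _∷_; lookup; toList)
open import Data.Vec.Relation.Unary.Linked using (Linked; linked?)
open import Function.Base using (_∘_; id)
open import Level using (0ℓ)
open import Relation.Binary.PropositionalEquality
  using (_≡_; refl; sym; trans; cong; cong₂; module ≡-Reasoning)
open import Relation.Nullary using (¬_; yes; no; contradiction)
open import Relation.Nullary.Decidable using (_×-dec_; _→-dec_)
open import Relation.Unary using (Decidable)

-- A polynomial is its list of coefficients, constant term first.
-- Trailing zeros are allowed, so equality is coefficientwise.

module Polynomial {c ℓ} (R : RawRing c ℓ) where
  private module R = RawRing R

  Poly : Set c
  Poly = List R.Carrier

  coeff : Poly → ℕ → R.Carrier
  coeff []      _       = R.0#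
  coeff (a ∷ f) zero    = a
  coeff (a ∷ f) (suc n) = coeff f n

  infix  4 _≈_
  infixl 6 _+_
  infixl 7 _*_
  infix  8 -_

  _≈_ : Poly → Poly → Set ℓ
  f ≈ g = ∀ n → coeff f n R.≈ coeff g n

  _+_ : Poly → Poly → Poly
  []      + g       = g
  (a ∷ f) + []      = a ∷ f
  (a ∷ f) + (b ∷ g) = (a R.+ b) ∷ (f + g)

  _*_ : Poly → Poly → Poly
  []      * g = []
  (a ∷ f) * g = List.map (a R.*_) g + (R.0# ∷ f * g)

  -_ : Poly → Poly
  -_ = List.map R.-_

  0# 1# X : Poly
  0# = []
  1# = R.1# ∷ []
  X  = R.0# ∷ R.1# ∷ []

  rawRing : RawRing c ℓ
  rawRing = record
    { Carrier = Poly
    ; _≈_     = _≈_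
    ; _+_     = _+_
    ; _*_     = _*_
    ; -_      = -_
    ; 0#      = 0#
    ; 1#      = 1#
    }

  open RawSemiringDefs (RawRing.rawSemiring rawRing) public
    using (_^_; _∣_; Coprime)

module ℤ[q] = Polynomial ℤ.+-*-rawRing
module ℚ[q] = Polynomial ℚ.+-*-rawRing

ℤ[q] ℚ[q] : Set
ℤ[q] = ℤ[q].Poly
ℚ[q] = ℚ[q].Poly

toℚ[q] : ℤ[q] → ℚ[q]
toℚ[q] = List.map (ℚ._/ 1)

q : ℤ[q]
q = ℤ[q].X

-- The q-integer 1 + q + ⋯ + qⁿ⁻¹.
[_]q : ℕ → ℤ[q]
[ n ]q = replicate n 1ℤ

-- ℤ[q] has no zero divisors, so fractions can be multiplied.

record NonZero (f : ℤ[q]) : Set where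
  constructor nonZero
  field
    ≉0 : ¬ (f ℤ[q].≈ ℤ[q].0#)

private
  open ℤ[q] using (coeff)

  coeff-+ : ∀ f g n → coeff (f ℤ[q].+ g) n ≡ coeff f n ℤ.+ coeff g n
  coeff-+ []      g       n       = sym (ℤ.+-identityˡ (coeff g n))
  coeff-+ (a ∷ f) []      n       = sym (ℤ.+-identityʳ (coeff (a ∷ f) n))
  coeff-+ (a ∷ f) (b ∷ g) zero    = refl
  coeff-+ (a ∷ f) (b ∷ g) (suc n) = coeff-+ f g n

  coeff-map-* : ∀ a g n → coeff (List.map (a ℤ.*_) g) n ≡ a ℤ.* coeff g n
  coeff-map-* a []      n       = sym (ℤ.*-zeroʳ a)
  coeff-map-* a (b ∷ g) zero    = refl
  coeff-map-* a (b ∷ g) (suc n) = coeff-map-* a g n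

  coeff-∷-* : ∀ a f g n → coeff ((a ∷ f) ℤ[q].* g) n ≡
              a ℤ.* coeff g n ℤ.+ coeff (0ℤ ∷ f ℤ[q].* g) n
  coeff-∷-* a f g n = trans
    (coeff-+ (List.map (a ℤ.*_) g) (0ℤ ∷ f ℤ[q].* g) n)
    (cong (ℤ._+ coeff (0ℤ ∷ f ℤ[q].* g) n) (coeff-map-* a g n))

  ZeroBelow : ℤ[q] → ℕ → Set
  ZeroBelow g n = ∀ m → m ℕ.< n → coeff g m ≡ 0ℤ

  *-zeroBelow : ∀ f g n → ZeroBelow g n → ZeroBelow (f ℤ[q].* g) n
  shift-zeroBelow : ∀ f g n → ZeroBelow g n → coeff (0ℤ ∷ f ℤ[q].* g) n ≡ 0ℤ

  *-zeroBelow []      g n z m m<n = refl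
  *-zeroBelow (a ∷ f) g n z m m<n = begin
    coeff ((a ∷ f) ℤ[q].* g) m                      ≡⟨ coeff-∷-* a f g m ⟩
    a ℤ.* coeff g m ℤ.+ coeff (0ℤ ∷ f ℤ[q].* g) m   ≡⟨ cong₂ (λ x y → a ℤ.* x ℤ.+ y) (z m m<n)
                                                         (shift-zeroBelow f g m λ k k<m → z k (ℕ.<-trans k<m m<n)) ⟩
    a ℤ.* 0ℤ ℤ.+ 0ℤ                                 ≡⟨ trans (ℤ.+-identityʳ (a ℤ.* 0ℤ)) (ℤ.*-zeroʳ a) ⟩
    0ℤ                                              ∎
    where open ≡-Reasoning

  shift-zeroBelow f g zero    z = refl
  shift-zeroBelow f g (suc n) z =
    *-zeroBelow f g (suc n) z n ℕ.≤-refl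

  all-below⇒≈0 : ∀ g → (∀ n → ZeroBelow g n → coeff g n ≡ 0ℤ) → g ℤ[q].≈ []
  all-below⇒≈0 g step n = below (suc n) n ℕ.≤-refl
    where
    below : ∀ n → ZeroBelow g n
    below (suc n) m (s≤s m≤n) =
      step m λ k k<m → below n k (ℕ.<-≤-trans k<m m≤n)

  *-≈0 : ∀ f g → f ℤ[q].* g ℤ[q].≈ [] → f ℤ[q].≈ [] ⊎ g ℤ[q].≈ []
  *-≈0 []      g fg≈0 = inj₁ λ _ → refl
  *-≈0 (a ∷ f) g fg≈0 with a ℤ.≟ 0ℤ
  ... | yes refl = [ (λ f≈0 → inj₁ λ { zero → refl ; (suc n) → f≈0 n }) , inj₂ ]′
                   (*-≈0 f g λ n → begin
    coeff (f ℤ[q].* g) n                                ≡⟨ ℤ.+-identityˡ _ ⟨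
    0ℤ ℤ.+ coeff (f ℤ[q].* g) n                         ≡⟨ coeff-∷-* 0ℤ f g (suc n) ⟨
    coeff ((0ℤ ∷ f) ℤ[q].* g) (suc n)                   ≡⟨ fg≈0 (suc n) ⟩
    0ℤ                                                  ∎)
    where open ≡-Reasoning
  ... | no a≢0 = inj₂ (all-below⇒≈0 g λ n z →
    [ (λ a≡0 → contradiction a≡0 a≢0) , id ]′
    (ℤ.i*j≡0⇒i≡0∨j≡0 a (begin
      a ℤ.* coeff g n                                   ≡⟨ ℤ.+-identityʳ _ ⟨
      a ℤ.* coeff g n ℤ.+ 0ℤ                            ≡⟨ cong (λ x → a ℤ.* coeff g n ℤ.+ x) (shift-zeroBelow f g n z) ⟨
      a ℤ.* coeff g n ℤ.+ coeff (0ℤ ∷ f ℤ[q].* g) n     ≡⟨ coeff-∷-* a f g n ⟨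
      coeff ((a ∷ f) ℤ[q].* g) n                        ≡⟨ fg≈0 n ⟩
      0ℤ                                                ∎)))
    where
    open ≡-Reasoning

*-nonZero : ∀ {f g} → NonZero f → NonZero g → NonZero (f ℤ[q].* g)
*-nonZero {f} {g} (nonZero f≉0) (nonZero g≉0) = nonZero ([ f≉0 , g≉0 ]′ ∘ *-≈0 f g)

1-nonZero : NonZero ℤ[q].1#
1-nonZero = nonZero λ 1≈0 → contradiction (1≈0 0) λ ()

^-nonZero : ∀ {f} n → NonZero f → NonZero (f ℤ[q].^ n)
^-nonZero zero    f≉0 = 1-nonZero
^-nonZero (suc n) f≉0 = *-nonZero f≉0 (^-nonZero n f≉0)

[1+_]q-nonZero : ∀ n → NonZero [ suc n ]q
[1+ n ]q-nonZero = nonZero λ f≈0 → contradiction (f≈0 0) λ ()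

-- The field ℚ(q), as fractions of elements of ℤ[q].

record ℚ⟨q⟩ : Set where
  constructor mk
  field
    num   : ℤ[q]
    den   : ℤ[q]
    den≉0 : NonZero den

open ℚ⟨q⟩ public

infix  4 _≈_
infixl 6 _+_
infixl 7 _*_
infix  8 -_

_≈_ : ℚ⟨q⟩ → ℚ⟨q⟩ → Set
A ≈ B = num A ℤ[q].* den B ℤ[q].≈ num B ℤ[q].* den A

_+_ _*_ : ℚ⟨q⟩ → ℚ⟨q⟩ → ℚ⟨q⟩
A + B = mk (num A ℤ[q].* den B ℤ[q].+ num B ℤ[q].* den A)
           (den A ℤ[q].* den B) (*-nonZero (den≉0 A) (den≉0 B))
A * B = mk (num A ℤ[q].* num B) (den A ℤ[q].* den B) (*-nonZero (den≉0 A) (den≉0 B))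

-_ : ℚ⟨q⟩ → ℚ⟨q⟩
- A = mk (ℤ[q].- num A) (den A) (den≉0 A)

0# 1# : ℚ⟨q⟩
0# = mk ℤ[q].0# ℤ[q].1# 1-nonZero
1# = mk ℤ[q].1# ℤ[q].1# 1-nonZero

ℚ⟨q⟩-rawRing : RawRing 0ℓ 0ℓ
ℚ⟨q⟩-rawRing = record
  { Carrier = ℚ⟨q⟩
  ; _≈_     = _≈_
  ; _+_     = _+_
  ; _*_     = _*_
  ; -_      = -_
  ; 0#      = 0#
  ; 1#      = 1#
  }

open RawSemiringDefs (RawRing.rawSemiring ℚ⟨q⟩-rawRing) public using (_^_)

infix 4 _≡_[mod_]

_≡_[mod_] : ℚ⟨q⟩ → ℚ⟨q⟩ → ℤ[q] → Set
A ≡ B [mod m ] = ∃ λ (C : ℚ⟨q⟩) →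
  A + - B ≈ C × ℚ[q].Coprime (toℚ[q] (den C)) (toℚ[q] m) × m ℤ[q].∣ num C

∑ ∏ : ∀ {a} {A : Set a} → List A → (A → ℚ⟨q⟩) → ℚ⟨q⟩
∑ xs f = foldr (λ x → f x +_) 0# xs
∏ xs f = foldr (λ x → f x *_) 1# xs

infix 5 ∑ ∏
syntax ∑ xs (λ x → e) = ∑[ x ∈ xs ] e
syntax ∏ xs (λ x → e) = ∏[ x ∈ xs ] e

-- The range {1,…,n} is encoded by Fin n, with i standing for ⟦ i ⟧; this
-- preserves and reflects _≤_ and _<_.

⟦_⟧ : ∀ {n} → Fin n → ℕ
⟦ i ⟧ = suc (toℕ i)

tuples : ∀ n l → List (Vec (Fin n) l)
tuples n zero    = [] ∷ []
tuples n (suc l) = cartesianProductWith _∷_ (allFin n) (tuples n l)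

increasing : ∀ n l → List (Vec (Fin n) l)
increasing n l = filter (linked? Fin._<?_) (tuples n l)

-- The list s₁ , s₁ + s₂ , … , s₁ + ⋯ + sₗ₋₁.
partialSums : ∀ {l} → Vec ℕ l → List ℕ
partialSums {l} s = applyUpTo (λ m → sum (List.take (suc m) (toList s))) (pred l)

-- Weakly increasing, and strictly so from position i to i + 1 for i ∈ I,
-- positions being counted from 1.
IncreasingStrictAt : List ℕ → ∀ {n w} → Vec (Fin n) w → Set
IncreasingStrictAt I {n} {w} j = ∀ (a b : Fin w) → ⟦ b ⟧ ≡ suc ⟦ a ⟧ →
  lookup j a Fin.≤ lookup j b × (⟦ a ⟧ ∈ I → lookup j a Fin.< lookup j b)

increasingStrictAt? : ∀ I {n w} → Decidable (IncreasingStrictAt I {n} {w})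
increasingStrictAt? I j = all? λ a → all? λ b → (⟦ b ⟧ ℕ.≟ suc ⟦ a ⟧) →-dec
  ((lookup j a Fin.≤? lookup j b) ×-dec
   (⟦ a ⟧ ∈? I →-dec (lookup j a Fin.<? lookup j b)))

increasingStrictAt : List ℕ → ∀ n w → List (Vec (Fin n) w)
increasingStrictAt I n w = filter (increasingStrictAt? I) (tuples n w)

-- The exponents act on q and on the q-integer [k]; k ranges over {1,…,n}.
q^_/[_]^_ : ℕ → ∀ {n} → Fin n → ℕ → ℚ⟨q⟩
q^ a /[ k ]^ b =
  mk (q ℤ[q].^ a) ([ ⟦ k ⟧ ]q ℤ[q].^ b) (^-nonZero b [1+ toℕ k ]q-nonZero)

H : ∀ (n : ℕ) {l} → Vec ℕ l → ℚ⟨q⟩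
H n {l} s = ∑[ k ∈ increasing n l ] ∏[ i ∈ allFin l ]
  q^ ((lookup s i ∸ 1) ℕ.* ⟦ lookup k i ⟧) /[ lookup k i ]^ lookup s i

{-# OPTIONS --safe #-}
module Submission where

-- Put N = p - 1. The q-integers [k] with 1 ≤ k ≤ N are units modulo [p], by
-- Bézout in ℕ, so the congruence is an identity in the ring ℤ[q]/[p].
--
-- Let e(n,k) = (-1)ᵏ q^(k(k+1)/2) [n choose k]_q. The two sides are matrix
-- products, with one factor for each summation index, and e intertwines the
-- factors: for k ≥ 1 and i ≥ 0,
--   e(n,k) qᵏ/[k]         =   Σ_{1 ≤ j ≤ n} (qʲ/[j]) e(j,k),
--   Σ_{k > i} e(n,k) /[k] = - Σ_{1 ≤ j ≤ n} (qʲ/[j]) e(j-1,i).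
-- An exponent s contributes one factor of the second kind and s - 1 of the
-- first. Finally e(N,k) = 1 modulo [p] removes the weight e from the left.

open import Algebra.Bundles using (CommutativeRing)
open import Algebra.Definitions.RawMagma using () renaming (_,_ to _∣,_)
import Algebra.Properties.CommutativeSemigroup as CommutativeSemigroupProperties
import Algebra.Properties.Ring as RingProperties
import Algebra.Properties.Semiring.Exp as Exp
import Algebra.Properties.Semiring.Sum as Sum
import Algebra.Solver.Ring.NaturalCoefficients.Default as SemiringSolver
open import Algebra.Structures using (IsCommutativeRing)
open import Data.Bool.Base using (Bool; true; false; if_then_else_; _∧_)
open import Data.Fin.Base as Fin using (Fin; zero; suc; toℕ; fromℕ<; splitAt)
import Data.Fin.Properties as Fin
open import Data.Integer.Base as ℤ using (0ℤ)
import Data.Integer.Properties as ℤ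
open import Data.List.Base as List using (List; []; _∷_; allFin; cartesianProductWith)
open import Data.List.Membership.Propositional using (_∈_)
open import Data.List.Membership.Propositional.Properties using (∈-applyUpTo⁺; ∈-applyUpTo⁻)
open import Data.Nat.Base as ℕ using (ℕ; zero; suc; _∸_; _≤_; _<_; _<ᵇ_; z≤n; s≤s)
open import Data.Nat.Coprimality using (prime⇒coprime; coprime-Bézout)
open import Data.Nat.GCD using (module Bézout)
open import Data.Nat.ListAction using () renaming (sum to listSum)
open import Data.Nat.Primality using (Prime; ¬prime[0])
import Data.Nat.Properties as ℕ
open import Data.Product.Base using (∃; _×_; _,_; proj₁; proj₂)
open import Data.Rational.Base as ℚ using (fromℚᵘ; toℚᵘ)
import Data.Rational.Properties as ℚ
import Data.Rational.Unnormalised.Base as ℚᵘ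
import Data.Rational.Unnormalised.Properties as ℚᵘ
open import Data.Sum.Base using (_⊎_; inj₁; inj₂)
open import Data.Unit.Base using (⊤; tt)
open import Data.Vec.Base as Vec using (Vec; []; _∷_; lookup; toList; replicate; _++_)
import Data.Vec.Properties as Vec
open import Data.Vec.Relation.Unary.All using (All; []; _∷_)
open import Data.Vec.Relation.Unary.Linked using (Linked; []; [-]; _∷_; linked?)
open import Function.Base using (_∘_)
open import Function.Bundles using (_⇔_; mk⇔; Equivalence)
open import Level using (_⊔_)
open import Relation.Binary.Bundles using (Setoid)
open import Relation.Binary.PropositionalEquality as ≡ using (_≡_)
import Relation.Binary.Reasoning.Setoid as SetoidReasoning
open import Relation.Binary.Structures using (IsEquivalence)
open import Relation.Nullary using (¬_; Dec; yes; contradiction)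
open import Relation.Nullary.Decidable using (does; does-⇔; _×-dec_)
open import Relation.Unary using (Decidable)

open import Defs using
  ( module Polynomial; module ℤ[q]; module ℚ[q]; ℤ[q]; toℚ[q]; ⟦_⟧; tuples; partialSums
  ; increasing; IncreasingStrictAt; increasingStrictAt; increasingStrictAt? )

-- Polynomials over a commutative ring

-- The value e(N,k) = 1 has a conceptual origin: modulo [p], q behaves as a primitive p-th root of
-- unity, so the product of 1 - qʲx over 1 ≤ j ≤ p - 1 is (1 - xᵖ)/(1 - x) = 1 + x + ⋯ + xᵖ⁻¹. At q
-- = 1 the array e is (-1)ᵏ (n choose k), the kernel of the binomial transform.
--
-- The obstacle is that each index is bounded by its neighbour, so an inner sum is a function of the
-- preceding index and not a number. The induction therefore carries a relation `Dual f g` between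
-- functions on {1,...,N}, whose kernel is the increment e(m,k) - e(m-1,k) and not e itself. Summing
-- increments up to a bound gives back e at that bound, so summation by parts trades an inequality
-- between consecutive indices for a value of e. The induction runs from the innermost sum outwards;
-- e(N,k) = 1 starts it, and the outermost sum closes it with e(m,0) = 1.

module PolynomialRing {c ℓ} (R : CommutativeRing c ℓ) where
  private module R = CommutativeRing R
  open Polynomial R.rawRing
  open RingProperties R.ring using (-0#≈0#)
  open CommutativeSemigroupProperties R.+-commutativeSemigroup using () renaming (interchange to +-medial)

  coeff-+ : ∀ f g n → coeff (f + g) n R.≈ coeff f n R.+ coeff g n
  coeff-+ []      g       n       = R.sym (R.+-identityˡ _)
  coeff-+ (a ∷ f) []      n       = R.sym (R.+-identityʳ _)
  coeff-+ (a ∷ f) (b ∷ g) zero    = R.refl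
  coeff-+ (a ∷ f) (b ∷ g) (suc n) = coeff-+ f g n

  coeff-neg : ∀ f n → coeff (- f) n R.≈ R.- coeff f n
  coeff-neg []      n       = R.sym -0#≈0#
  coeff-neg (a ∷ f) zero    = R.refl
  coeff-neg (a ∷ f) (suc n) = coeff-neg f n

  -- A record, unlike Polynomial._≈_, lets f and g be inferred from a proof.
  infix 4 _≋_
  record _≋_ (f g : Poly) : Set ℓ where
    constructor coeffwise
    field at : f ≈ g

  open _≋_

  ≋-isEquivalence : IsEquivalence _≋_
  ≋-isEquivalence = record
    { refl  = coeffwise λ n → R.refl
    ; sym   = λ f≈g → coeffwise λ n → R.sym (at f≈g n)
    ; trans = λ f≈g g≈h → coeffwise λ n → R.trans (at f≈g n) (at g≈h n)
    }

  open IsEquivalence ≋-isEquivalence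

  +-cong : ∀ {f f′ g g′} → f ≋ f′ → g ≋ g′ → f + g ≋ f′ + g′
  +-cong {f} {f′} {g} {g′} f≈f′ g≈g′ = coeffwise λ n →
    R.trans (coeff-+ f g n) (R.trans (R.+-cong (at f≈f′ n) (at g≈g′ n)) (R.sym (coeff-+ f′ g′ n)))

  +-assoc : ∀ f g h → (f + g) + h ≋ f + (g + h)
  +-assoc f g h = coeffwise λ n → begin
    coeff ((f + g) + h) n                      ≈⟨ coeff-+ (f + g) h n ⟩
    coeff (f + g) n R.+ coeff h n              ≈⟨ R.+-congʳ (coeff-+ f g n) ⟩
    coeff f n R.+ coeff g n R.+ coeff h n      ≈⟨ R.+-assoc _ _ _ ⟩
    coeff f n R.+ (coeff g n R.+ coeff h n)    ≈⟨ R.+-congˡ (coeff-+ g h n) ⟨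
    coeff f n R.+ coeff (g + h) n              ≈⟨ coeff-+ f (g + h) n ⟨
    coeff (f + (g + h)) n                      ∎
    where open SetoidReasoning R.setoid

  +-comm : ∀ f g → f + g ≋ g + f
  +-comm f g = coeffwise λ n → R.trans (coeff-+ f g n) (R.trans (R.+-comm _ _) (R.sym (coeff-+ g f n)))

  +-identityʳ : ∀ f → f + 0# ≋ f
  +-identityʳ []      = refl
  +-identityʳ (a ∷ f) = refl

  -‿cong : ∀ {f g} → f ≋ g → - f ≋ - g
  -‿cong {f} {g} f≈g = coeffwise λ n →
    R.trans (coeff-neg f n) (R.trans (R.-‿cong (at f≈g n)) (R.sym (coeff-neg g n)))

  -‿inverseʳ : ∀ f → f + - f ≋ 0#
  -‿inverseʳ f = coeffwise λ n →
    R.trans (coeff-+ f (- f) n) (R.trans (R.+-congˡ (coeff-neg f n)) (R.-‿inverseʳ _))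

  ∷-cong : ∀ {a b f g} → a R.≈ b → f ≋ g → a ∷ f ≋ b ∷ g
  ∷-cong a≈b f≈g = coeffwise λ { zero → a≈b ; (suc n) → at f≈g n }

  0∷0≈0 : R.0# ∷ [] ≋ 0#
  0∷0≈0 = coeffwise λ { zero → R.refl ; (suc n) → R.refl }

  infixl 7 _·_
  _·_ : R.Carrier → Poly → Poly
  a · f = List.map (a R.*_) f

  coeff-· : ∀ a f n → coeff (a · f) n R.≈ a R.* coeff f n
  coeff-· a []      n       = R.sym (R.zeroʳ a)
  coeff-· a (b ∷ f) zero    = R.refl
  coeff-· a (b ∷ f) (suc n) = coeff-· a f n

  ·-cong : ∀ {a b f g} → a R.≈ b → f ≋ g → a · f ≋ b · g
  ·-cong {a} {b} {f} {g} a≈b f≈g = coeffwise λ n →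
    R.trans (coeff-· a f n) (R.trans (R.*-cong a≈b (at f≈g n)) (R.sym (coeff-· b g n)))

  ·-distribˡ : ∀ a f g → a · (f + g) ≋ a · f + a · g
  ·-distribˡ a f g = coeffwise λ n → begin
    coeff (a · (f + g)) n                       ≈⟨ coeff-· a (f + g) n ⟩
    a R.* coeff (f + g) n                       ≈⟨ R.*-congˡ (coeff-+ f g n) ⟩
    a R.* (coeff f n R.+ coeff g n)             ≈⟨ R.distribˡ _ _ _ ⟩
    a R.* coeff f n R.+ a R.* coeff g n         ≈⟨ R.+-cong (coeff-· a f n) (coeff-· a g n) ⟨
    coeff (a · f) n R.+ coeff (a · g) n         ≈⟨ coeff-+ (a · f) (a · g) n ⟨
    coeff (a · f + a · g) n                     ∎
    where open SetoidReasoning R.setoid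

  ·-distribʳ : ∀ a b f → (a R.+ b) · f ≋ a · f + b · f
  ·-distribʳ a b f = coeffwise λ n → begin
    coeff ((a R.+ b) · f) n                     ≈⟨ coeff-· (a R.+ b) f n ⟩
    (a R.+ b) R.* coeff f n                     ≈⟨ R.distribʳ _ _ _ ⟩
    a R.* coeff f n R.+ b R.* coeff f n         ≈⟨ R.+-cong (coeff-· a f n) (coeff-· b f n) ⟨
    coeff (a · f) n R.+ coeff (b · f) n         ≈⟨ coeff-+ (a · f) (b · f) n ⟨
    coeff (a · f + b · f) n                     ∎
    where open SetoidReasoning R.setoid

  ·-· : ∀ a b f → a · (b · f) ≋ (a R.* b) · f
  ·-· a b f = coeffwise λ n → begin
    coeff (a · (b · f)) n     ≈⟨ coeff-· a (b · f) n ⟩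
    a R.* coeff (b · f) n     ≈⟨ R.*-congˡ (coeff-· b f n) ⟩
    a R.* (b R.* coeff f n)   ≈⟨ R.*-assoc _ _ _ ⟨
    (a R.* b) R.* coeff f n   ≈⟨ coeff-· (a R.* b) f n ⟨
    coeff ((a R.* b) · f) n   ∎
    where open SetoidReasoning R.setoid

  0·f≈0 : ∀ f → R.0# · f ≋ 0#
  0·f≈0 f = coeffwise λ n → R.trans (coeff-· R.0# f n) (R.zeroˡ _)

  1·f≈f : ∀ f → R.1# · f ≋ f
  1·f≈f f = coeffwise λ n → R.trans (coeff-· R.1# f n) (R.*-identityˡ _)

  ·-shift : ∀ a f → a · (R.0# ∷ f) ≋ R.0# ∷ a · f
  ·-shift a f = ∷-cong (R.zeroʳ a) refl

  medial : ∀ f g h k → (f + g) + (h + k) ≋ (f + h) + (g + k)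
  medial f g h k = coeffwise λ n → begin
    coeff ((f + g) + (h + k)) n
      ≈⟨ R.trans (coeff-+ (f + g) (h + k) n) (R.+-cong (coeff-+ f g n) (coeff-+ h k n)) ⟩
    (coeff f n R.+ coeff g n) R.+ (coeff h n R.+ coeff k n) ≈⟨ +-medial _ _ _ _ ⟩
    (coeff f n R.+ coeff h n) R.+ (coeff g n R.+ coeff k n)
      ≈⟨ R.trans (coeff-+ (f + h) (g + k) n) (R.+-cong (coeff-+ f h n) (coeff-+ g k n)) ⟨
    coeff ((f + h) + (g + k)) n  ∎
    where open SetoidReasoning R.setoid

  private
    ≋-setoid : Setoid c ℓ
    ≋-setoid = record { isEquivalence = ≋-isEquivalence }

  open SetoidReasoning ≋-setoid

  shift-+ : ∀ f g → R.0# ∷ (f + g) ≋ (R.0# ∷ f) + (R.0# ∷ g)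
  shift-+ f g = ∷-cong (R.sym (R.+-identityˡ _)) refl

  distribʳ : ∀ h f g → (f + g) * h ≋ f * h + g * h
  distribʳ h []      g       = refl
  distribʳ h (a ∷ f) []      = sym (+-identityʳ _)
  distribʳ h (a ∷ f) (b ∷ g) = begin
    (a R.+ b) · h + (R.0# ∷ (f + g) * h)
      ≈⟨ +-cong (·-distribʳ a b h) (∷-cong R.refl (distribʳ h f g)) ⟩
    (a · h + b · h) + (R.0# ∷ (f * h + g * h))
      ≈⟨ +-cong refl (shift-+ (f * h) (g * h)) ⟩
    (a · h + b · h) + ((R.0# ∷ f * h) + (R.0# ∷ g * h))
      ≈⟨ medial (a · h) (b · h) (R.0# ∷ f * h) (R.0# ∷ g * h) ⟩
    (a ∷ f) * h + (b ∷ g) * h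
      ∎

  *-congˡ : ∀ f {g h} → g ≋ h → f * g ≋ f * h
  *-congˡ []      g≈h = refl
  *-congˡ (a ∷ f) g≈h = +-cong (·-cong R.refl g≈h) (∷-cong R.refl (*-congˡ f g≈h))

  *-zeroʳ : ∀ f → f * 0# ≋ 0#
  *-zeroʳ []      = refl
  *-zeroʳ (a ∷ f) = trans (∷-cong R.refl (*-zeroʳ f)) 0∷0≈0

  -- Mirrors the defining equation of `_*_` in the second factor, which lets `*-comm` recurse on
  -- that factor.
  *-∷ : ∀ f b g → f * (b ∷ g) ≋ b · f + (R.0# ∷ f * g)
  *-∷ []      b g = sym 0∷0≈0
  *-∷ (a ∷ f) b g = ∷-cong (R.+-congʳ (R.*-comm a b)) (begin
    a · g + f * (b ∷ g)              ≈⟨ +-cong refl (*-∷ f b g) ⟩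
    a · g + (b · f + (R.0# ∷ f * g)) ≈⟨ +-assoc (a · g) (b · f) _ ⟨
    (a · g + b · f) + (R.0# ∷ f * g) ≈⟨ +-cong (+-comm (a · g) (b · f)) refl ⟩
    (b · f + a · g) + (R.0# ∷ f * g) ≈⟨ +-assoc (b · f) (a · g) _ ⟩
    b · f + (a · g + (R.0# ∷ f * g)) ∎)

  *-comm : ∀ f g → f * g ≋ g * f
  *-comm f []      = *-zeroʳ f
  *-comm f (b ∷ g) = trans (*-∷ f b g) (+-cong refl (∷-cong R.refl (*-comm f g)))

  -- `_*_` recurses on its left list, and equal polynomials may differ in length by trailing zeros;
  -- congruence on the left is therefore obtained from `*-congˡ` by commutativity.
  *-cong : ∀ {f f′ g g′} → f ≋ f′ → g ≋ g′ → f * g ≋ f′ * g′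
  *-cong {f} {f′} {g} {g′} f≈f′ g≈g′ = begin
    f * g   ≈⟨ *-congˡ f g≈g′ ⟩
    f * g′  ≈⟨ *-comm f g′ ⟩
    g′ * f  ≈⟨ *-congˡ g′ f≈f′ ⟩
    g′ * f′ ≈⟨ *-comm g′ f′ ⟩
    f′ * g′ ∎

  ·-* : ∀ a f g → (a · f) * g ≋ a · (f * g)
  ·-* a []      g = refl
  ·-* a (b ∷ f) g = begin
    (a R.* b) · g + (R.0# ∷ (a · f) * g) ≈⟨ +-cong (sym (·-· a b g)) (∷-cong R.refl (·-* a f g)) ⟩
    a · (b · g) + (R.0# ∷ a · (f * g))   ≈⟨ +-cong {f = a · (b · g)} refl (sym (·-shift a (f * g))) ⟩
    a · (b · g) + a · (R.0# ∷ f * g)     ≈⟨ ·-distribˡ a (b · g) (R.0# ∷ f * g) ⟨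
    a · ((b ∷ f) * g)                    ∎

  shift-* : ∀ f g → (R.0# ∷ f) * g ≋ R.0# ∷ f * g
  shift-* f g = +-cong (0·f≈0 g) refl

  *-assoc : ∀ f g h → (f * g) * h ≋ f * (g * h)
  *-assoc []      g h = refl
  *-assoc (a ∷ f) g h = begin
    (a · g + (R.0# ∷ f * g)) * h        ≈⟨ distribʳ h (a · g) (R.0# ∷ f * g) ⟩
    (a · g) * h + (R.0# ∷ f * g) * h    ≈⟨ +-cong (·-* a g h) (shift-* (f * g) h) ⟩
    a · (g * h) + (R.0# ∷ (f * g) * h)  ≈⟨ +-cong {f = a · (g * h)} refl (∷-cong R.refl (*-assoc f g h)) ⟩
    a · (g * h) + (R.0# ∷ f * (g * h))  ∎

  *-identityˡ : ∀ f → 1# * f ≋ f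
  *-identityˡ f = trans (+-cong (1·f≈f f) 0∷0≈0) (+-identityʳ f)

  isCommutativeRing : IsCommutativeRing _≋_ _+_ _*_ -_ 0# 1#
  isCommutativeRing = record
    { isRing = record
      { +-isAbelianGroup = record
        { isGroup = record
          { isMonoid = record
            { isSemigroup = record
              { isMagma = record { isEquivalence = ≋-isEquivalence ; ∙-cong = +-cong }
              ; assoc = +-assoc }
            ; identity = (λ f → refl) , +-identityʳ }
          ; inverse = (λ f → trans (+-comm (- f) f) (-‿inverseʳ f)) , -‿inverseʳ
          ; ⁻¹-cong = -‿cong }
        ; comm = +-comm }
      ; *-cong = *-cong
      ; *-assoc = *-assoc
      ; *-identity = *-identityˡ , λ f → trans (*-comm f 1#) (*-identityˡ f)
      ; distrib = (λ f g h → trans (*-comm f (g + h))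
                    (trans (distribʳ f g h) (+-cong (*-comm g f) (*-comm h f)))) , distribʳ
      }
    ; *-comm = *-comm
    }

  commutativeRing : CommutativeRing c ℓ
  commutativeRing = record { isCommutativeRing = isCommutativeRing }

  X*-shift : ∀ f → X * f ≋ R.0# ∷ f
  X*-shift f = trans (shift-* 1# f) (∷-cong R.refl (*-identityˡ f))

  -- Links the run of ones `[ n ]q` to the recursion [n + 1] = 1 + q [n].
  1+X* : ∀ f → 1# + X * f ≋ R.1# ∷ f
  1+X* f = trans (+-cong {f = 1#} refl (X*-shift f)) (∷-cong (R.+-identityʳ R.1#) refl)

-- The quotient of a commutative ring by a principal ideal

module Quotient {c ℓ} (R : CommutativeRing c ℓ) (m : CommutativeRing.Carrier R) where
  open CommutativeRing R
  open RingProperties ring using (-‿distribˡ-*; -‿+-comm)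
  open SemiringSolver commutativeSemiring using (solve; _:+_; _:*_; _:=_)
  open SetoidReasoning setoid

  infix 4 _∼_
  -- The quotient is kept as data: later it serves as a Bézout coefficient for coprimality and as
  -- the cofactor that witnesses divisibility by m.
  record _∼_ (x y : Carrier) : Set (c ⊔ ℓ) where
    constructor _,_
    field
      quotient : Carrier
      equality : x ≈ y + quotient * m

  ≈⇒∼ : ∀ {x y} → x ≈ y → x ∼ y
  ≈⇒∼ x≈y = 0# , trans x≈y (sym (trans (+-congˡ (zeroˡ m)) (+-identityʳ _)))

  m∼0 : m ∼ 0#
  m∼0 = 1# , sym (trans (+-identityˡ _) (*-identityˡ m))

  ∼-sym : ∀ {x y} → x ∼ y → y ∼ x
  ∼-sym {x} {y} (a , x≈y+am) = - a , sym (begin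
    x + - a * m              ≈⟨ +-congʳ x≈y+am ⟩
    y + a * m + - a * m
      ≈⟨ solve 4 (λ y a b m → y :+ a :* m :+ b :* m := y :+ (a :+ b) :* m) refl y a (- a) m ⟩
    y + (a - a) * m          ≈⟨ +-congˡ (trans (*-congʳ (-‿inverseʳ a)) (zeroˡ m)) ⟩
    y + 0#                   ≈⟨ +-identityʳ y ⟩
    y                        ∎)

  ∼-trans : ∀ {x y z} → x ∼ y → y ∼ z → x ∼ z
  ∼-trans {x} {y} {z} (a , x≈y+am) (b , y≈z+bm) = b + a , (begin
    x                      ≈⟨ x≈y+am ⟩
    y + a * m              ≈⟨ +-congʳ y≈z+bm ⟩
    z + b * m + a * m      ≈⟨ solve 4 (λ z a b m → z :+ b :* m :+ a :* m := z :+ (b :+ a) :* m) refl z a b m ⟩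
    z + (b + a) * m        ∎)

  ∼-+-cong : ∀ {x y u v} → x ∼ y → u ∼ v → x + u ∼ y + v
  ∼-+-cong {x} {y} {u} {v} (a , x≈y+am) (b , u≈v+bm) = a + b , (begin
    x + u                          ≈⟨ +-cong x≈y+am u≈v+bm ⟩
    (y + a * m) + (v + b * m)
      ≈⟨ solve 5 (λ y a v b m → (y :+ a :* m) :+ (v :+ b :* m) := y :+ v :+ (a :+ b) :* m) refl y a v b m ⟩
    y + v + (a + b) * m            ∎)

  ∼-*-cong : ∀ {x y u v} → x ∼ y → u ∼ v → x * u ∼ y * v
  ∼-*-cong {x} {y} {u} {v} (a , x≈y+am) (b , u≈v+bm) = a * v + y * b + a * b * m , (begin
    x * u                              ≈⟨ *-cong x≈y+am u≈v+bm ⟩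
    (y + a * m) * (v + b * m)          ≈⟨ solve 5 (λ y a v b m → (y :+ a :* m) :* (v :+ b :* m) :=
                                            y :* v :+ (a :* v :+ y :* b :+ a :* b :* m) :* m) refl y a v b m ⟩
    y * v + (a * v + y * b + a * b * m) * m ∎)

  ∼-‿cong : ∀ {x y} → x ∼ y → - x ∼ - y
  ∼-‿cong {x} {y} (a , x≈y+am) = - a , (begin
    - x                ≈⟨ -‿cong x≈y+am ⟩
    - (y + a * m)      ≈⟨ -‿+-comm y (a * m) ⟨
    - y - a * m        ≈⟨ +-congˡ (-‿distribˡ-* a m) ⟩
    - y + - a * m      ∎)

  commutativeRing : CommutativeRing c (c ⊔ ℓ)
  commutativeRing = record
    { Carrier = Carrier
    ; _≈_ = _∼_
    ; _+_ = _+_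
    ; _*_ = _*_
    ; -_ = -_
    ; 0# = 0#
    ; 1# = 1#
    ; isCommutativeRing = record
      { isRing = record
        { +-isAbelianGroup = record
          { isGroup = record
            { isMonoid = record
              { isSemigroup = record
                { isMagma = record
                  { isEquivalence = record { refl = ≈⇒∼ refl ; sym = ∼-sym ; trans = ∼-trans }
                  ; ∙-cong = ∼-+-cong
                  }
                ; assoc = λ x y z → ≈⇒∼ (+-assoc x y z)
                }
              ; identity = (λ x → ≈⇒∼ (+-identityˡ x)) , (λ x → ≈⇒∼ (+-identityʳ x))
              }
            ; inverse = (λ x → ≈⇒∼ (-‿inverseˡ x)) , (λ x → ≈⇒∼ (-‿inverseʳ x))
            ; ⁻¹-cong = ∼-‿cong
            }
          ; comm = λ x y → ≈⇒∼ (+-comm x y)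
          }
        ; *-cong = ∼-*-cong
        ; *-assoc = λ x y z → ≈⇒∼ (*-assoc x y z)
        ; *-identity = (λ x → ≈⇒∼ (*-identityˡ x)) , (λ x → ≈⇒∼ (*-identityʳ x))
        ; distrib = (λ x y z → ≈⇒∼ (distribˡ x y z)) , (λ x y z → ≈⇒∼ (distribʳ x y z))
        }
      ; *-comm = λ x y → ≈⇒∼ (*-comm x y)
      }
    }

-- Chains of indices

-- Consecutive entries satisfy ⟦ x ⟧ < ⟦ y ⟧ + δ, with δ the slack at the
-- position of y; so δ = 0 means strict and δ = 1 weak increase. The number i
-- acts as a previous entry.
Chain : ∀ {n l} → Vec ℕ l → ℕ → Vec (Fin n) l → Set
Chain []       i []      = ⊤
Chain (δ ∷ δs) i (x ∷ v) = i < ⟦ x ⟧ ℕ.+ δ × Chain δs ⟦ x ⟧ v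

chain? : ∀ {n l} (δs : Vec ℕ l) i (v : Vec (Fin n) l) → Dec (Chain δs i v)
chain? []       i []      = yes tt
chain? (δ ∷ δs) i (x ∷ v) = (i ℕ.<? ⟦ x ⟧ ℕ.+ δ) ×-dec chain? δs ⟦ x ⟧ v

-- The starting number 0 constrains nothing, because ⟦ x ⟧ ≥ 1.
linked⇔chain : ∀ {n l} (v : Vec (Fin n) l) → Linked Fin._<_ v ⇔ Chain (replicate l 0) 0 v
linked⇔chain []      = mk⇔ (λ _ → tt) (λ _ → [])
linked⇔chain (x ∷ v) = mk⇔ (λ x∷v↗ → s≤s z≤n , to x v x∷v↗) (λ (_ , v↗) → from x v v↗)
  where
  to : ∀ {n l} (x : Fin n) (v : Vec (Fin n) l) → Linked Fin._<_ (x ∷ v) → Chain (replicate l 0) ⟦ x ⟧ v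
  to x []      [-]          = tt
  to x (y ∷ v) (x<y ∷ y∷v↗) = ≡.subst (⟦ x ⟧ <_) (≡.sym (ℕ.+-identityʳ _)) (s≤s x<y) , to y v y∷v↗

  from : ∀ {n l} (x : Fin n) (v : Vec (Fin n) l) → Chain (replicate l 0) ⟦ x ⟧ v → Linked Fin._<_ (x ∷ v)
  from x []      _          = [-]
  from x (y ∷ v) (x<y , v↗) = ℕ.s<s⁻¹ (≡.subst (⟦ x ⟧ <_) (ℕ.+-identityʳ _) x<y) ∷ from y v v↗

chain⇒ : ∀ {n l} (δs : Vec ℕ l) {i} (v : Vec (Fin n) l) → Chain δs i v →
         ∀ a b → toℕ b ≡ suc (toℕ a) → ⟦ lookup v a ⟧ < ⟦ lookup v b ⟧ ℕ.+ lookup δs b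
chain⇒ (_ ∷ _ ∷ _)  (_ ∷ _ ∷ _) (_ , x<y , _) zero    (suc zero) _  = x<y
chain⇒ (_ ∷ δs)     (_ ∷ v)     (_ , v↗)      (suc a) (suc b)    eq = chain⇒ δs v v↗ a b (ℕ.suc-injective eq)

⇒chain : ∀ {n l} (δs : Vec ℕ l) {i} (v : Vec (Fin n) l) →
         (∀ b → toℕ b ≡ 0 → i < ⟦ lookup v b ⟧ ℕ.+ lookup δs b) →
         (∀ a b → toℕ b ≡ suc (toℕ a) → ⟦ lookup v a ⟧ < ⟦ lookup v b ⟧ ℕ.+ lookup δs b) →
         Chain δs i v
⇒chain []       []      first next = tt
⇒chain (δ ∷ δs) (x ∷ v) first next =
  first zero ≡.refl ,
  ⇒chain δs v (λ b eq → next zero (suc b) (≡.cong suc eq))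
              (λ a b eq → next (suc a) (suc b) (≡.cong suc eq))

-- An exponent t on the left becomes t indices on the right, weakly increasing among themselves and
-- strictly above the preceding block.
block : ∀ t → Vec ℕ t
block zero    = []
block (suc t) = 0 ∷ replicate t 1

slacks : ∀ {l} (s : Vec ℕ l) → Vec ℕ (Vec.sum s)
slacks []      = []
slacks (t ∷ s) = block t ++ slacks s

-- Here b counts positions from 0, whereas I counts from 1 and names the position before the strict
-- step; the two shifts cancel, so b ranges over I together with 0. Including 0 makes the recursion
-- over blocks uniform.
BlockStart : ∀ {l} → Vec ℕ l → ℕ → Set
BlockStart {l} s b = ∃ λ m → m < l × b ≡ listSum (List.take m (toList s))

slack-cases : ∀ {l} (s : Vec ℕ l) → All (1 ≤_) s → ∀ b →
              lookup (slacks s) b ≡ 0 × BlockStart s (toℕ b) ⊎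
              lookup (slacks s) b ≡ 1 × ¬ BlockStart s (toℕ b)
slack-cases (suc t ∷ s) (_ ∷ s≥1) zero    = inj₁ (≡.refl , 0 , s≤s z≤n , ≡.refl)
slack-cases (suc t ∷ s) (_ ∷ s≥1) (suc b) with splitAt t b | Fin.join-splitAt t (Vec.sum s) b
... | inj₁ c | ≡.refl = inj₂ (≡.trans (Vec.lookup-++ˡ (replicate t 1) (slacks s) c) (Vec.lookup-replicate c 1) , λ
  -- A block start other than 0 is at least t + 1, while this position is at most t.
  { (suc m , _ , eq) → ℕ.<⇒≢ (ℕ.<-≤-trans (Fin.toℕ<n c) (ℕ.m≤m+n t _))
                             (≡.trans (≡.sym (Fin.toℕ-↑ˡ c (Vec.sum s))) (ℕ.suc-injective eq)) })
... | inj₂ c | ≡.refl with slack-cases s s≥1 c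
...   | inj₁ (δ≡0 , m , m<l , eq) = inj₁ (≡.trans (Vec.lookup-++ʳ (replicate t 1) (slacks s) c) δ≡0 ,
  suc m , s≤s m<l , ≡.cong suc (≡.trans (Fin.toℕ-↑ʳ t c) (≡.cong (t ℕ.+_) eq)))
...   | inj₂ (δ≡1 , ¬start) = inj₂ (≡.trans (Vec.lookup-++ʳ (replicate t 1) (slacks s) c) δ≡1 , λ
  { (suc m , s≤s m<l , eq) → ¬start (m , m<l , ℕ.+-cancelˡ-≡ t _ _
      (≡.trans (≡.sym (Fin.toℕ-↑ʳ t c)) (ℕ.suc-injective eq))) })

partialSums⇔ : ∀ {l} (s : Vec ℕ l) b → suc b ∈ partialSums s ⇔ BlockStart s (suc b)
partialSums⇔ []      b = mk⇔ (λ ()) (λ ())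
partialSums⇔ {suc l} (t ∷ s) b = mk⇔
  (λ b∈ → let m , m<l , eq = ∈-applyUpTo⁻ f b∈ in suc m , s≤s m<l , eq)
  (λ { (suc m , s≤s m<l , eq) → ≡.subst (_∈ partialSums (t ∷ s)) (≡.sym eq) (∈-applyUpTo⁺ f m<l) })
  where f = λ m → listSum (List.take (suc m) (toList (t ∷ s)))

increasingStrictAt⇔chain : ∀ {n l} (s : Vec ℕ l) → All (1 ≤_) s → (v : Vec (Fin n) (Vec.sum s)) →
                           IncreasingStrictAt (partialSums s) v ⇔ Chain (slacks s) 0 v
increasingStrictAt⇔chain s s≥1 v = mk⇔
  (λ incr → ⇒chain (slacks s) v (λ b _ → s≤s z≤n) (λ a b eq → to a b eq (incr a b (≡.cong suc eq))))
  (λ v↗ a b eq → from a b (ℕ.suc-injective eq) (chain⇒ (slacks s) v v↗ a b (ℕ.suc-injective eq)))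
  where
  start⇔ : ∀ a b → toℕ b ≡ suc (toℕ a) → ⟦ a ⟧ ∈ partialSums s ⇔ BlockStart s (toℕ b)
  start⇔ a b eq rewrite eq = partialSums⇔ s (toℕ a)

  to : ∀ a b → toℕ b ≡ suc (toℕ a) →
       lookup v a Fin.≤ lookup v b × (⟦ a ⟧ ∈ partialSums s → lookup v a Fin.< lookup v b) →
       ⟦ lookup v a ⟧ < ⟦ lookup v b ⟧ ℕ.+ lookup (slacks s) b
  to a b eq (x≤y , x<y) with slack-cases s s≥1 b
  ... | inj₁ (δ≡0 , start) rewrite δ≡0 | ℕ.+-identityʳ (toℕ (lookup v b)) =
    s≤s (x<y (Equivalence.from (start⇔ a b eq) start))
  ... | inj₂ (δ≡1 , _)     rewrite δ≡1 | ℕ.+-comm (toℕ (lookup v b)) 1 = s≤s (s≤s x≤y)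

  from : ∀ a b → toℕ b ≡ suc (toℕ a) →
         ⟦ lookup v a ⟧ < ⟦ lookup v b ⟧ ℕ.+ lookup (slacks s) b →
         lookup v a Fin.≤ lookup v b × (⟦ a ⟧ ∈ partialSums s → lookup v a Fin.< lookup v b)
  from a b eq x<y+δ with slack-cases s s≥1 b
  ... | inj₁ (δ≡0 , _)      rewrite δ≡0 | ℕ.+-identityʳ (toℕ (lookup v b)) =
    ℕ.<⇒≤ (ℕ.s<s⁻¹ x<y+δ) , λ _ → ℕ.s<s⁻¹ x<y+δ
  ... | inj₂ (δ≡1 , ¬start) rewrite δ≡1 | ℕ.+-comm (toℕ (lookup v b)) 1 =
    ℕ.s≤s⁻¹ (ℕ.s≤s⁻¹ x<y+δ) , λ a∈I → contradiction (Equivalence.to (start⇔ a b eq) a∈I) ¬start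

-- The duality in a ring where [1], …, [N] are invertible and [N + 1] = 0

module QAnalogue {c ℓ} (R : CommutativeRing c ℓ) (q : CommutativeRing.Carrier R) where
  open CommutativeRing R hiding (zero)
  open Exp semiring using (_^_; ^-homo-*)
  open RingProperties ring using (+-cancelʳ; -‿distribˡ-*; -‿distribʳ-*; +-inverseˡ-unique; -1*x≈-x)
  open CommutativeSemigroupProperties *-commutativeSemigroup using (x∙yz≈y∙xz; interchange)
  open SemiringSolver commutativeSemiring using (solve; _:+_; _:*_; _:=_)
  open SetoidReasoning setoid

  -- Moves subtractions to the other side, where the semiring solver applies.
  x-y+y≈x : ∀ x y → x - y + y ≈ x
  x-y+y≈x x y = trans (+-assoc x (- y) y) (trans (+-congˡ (-‿inverseˡ y)) (+-identityʳ x))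

  -- q-integers and their invertibility

  ⟨_⟩ : ℕ → Carrier
  ⟨ zero ⟩  = 0#
  ⟨ suc n ⟩ = 1# + q * ⟨ n ⟩

  ⟨⟩-+ : ∀ m n → ⟨ m ℕ.+ n ⟩ ≈ ⟨ m ⟩ + q ^ m * ⟨ n ⟩
  ⟨⟩-+ zero    n = sym (trans (+-identityˡ _) (*-identityˡ _))
  ⟨⟩-+ (suc m) n = begin
    1# + q * ⟨ m ℕ.+ n ⟩                  ≈⟨ +-congˡ (*-congˡ (⟨⟩-+ m n)) ⟩
    1# + q * (⟨ m ⟩ + q ^ m * ⟨ n ⟩)
      ≈⟨ solve 5 (λ u q a t b → u :+ q :* (a :+ t :* b) := (u :+ q :* a) :+ (q :* t) :* b)
                                               refl 1# q ⟨ m ⟩ (q ^ m) ⟨ n ⟩ ⟩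
    ⟨ suc m ⟩ + q ^ suc m * ⟨ n ⟩         ∎

  ⟨1⟩ : ⟨ 1 ⟩ ≈ 1#
  ⟨1⟩ = trans (+-congˡ (zeroʳ q)) (+-identityʳ 1#)

  ⟨⟩-suc : ∀ n → ⟨ suc n ⟩ ≈ ⟨ n ⟩ + q ^ n
  ⟨⟩-suc n = begin
    ⟨ suc n ⟩              ≡⟨ ≡.cong ⟨_⟩ (ℕ.+-comm 1 n) ⟩
    ⟨ n ℕ.+ 1 ⟩            ≈⟨ ⟨⟩-+ n 1 ⟩
    ⟨ n ⟩ + q ^ n * ⟨ 1 ⟩  ≈⟨ +-congˡ (trans (*-congˡ ⟨1⟩) (*-identityʳ _)) ⟩
    ⟨ n ⟩ + q ^ n          ∎

  ⟨⟩-* : ∀ m n → ∃ λ a → ⟨ m ℕ.* n ⟩ ≈ ⟨ n ⟩ * a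
  ⟨⟩-* zero    n = 0# , sym (zeroʳ _)
  ⟨⟩-* (suc m) n with ⟨⟩-* m n
  ... | a , eq = 1# + q ^ n * a , (begin
    ⟨ n ℕ.+ m ℕ.* n ⟩                ≈⟨ ⟨⟩-+ n (m ℕ.* n) ⟩
    ⟨ n ⟩ + q ^ n * ⟨ m ℕ.* n ⟩      ≈⟨ +-cong (sym (*-identityʳ _)) (*-congˡ eq) ⟩
    ⟨ n ⟩ * 1# + q ^ n * (⟨ n ⟩ * a) ≈⟨ solve 4 (λ u n t a → n :* u :+ t :* (n :* a) := n :* (u :+ t :* a))
                                          refl 1# ⟨ n ⟩ (q ^ n) a ⟩
    ⟨ n ⟩ * (1# + q ^ n * a)         ∎)

  -- A Bézout identity between p and k passes to q-integers: [xp] vanishes, [yk] is a multiple of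
  -- [k], and the summand 1 is handled by [n + 1] = 1 + q [n].
  ⟨⟩-invertible : ∀ {p k} → Prime p → .{{ℕ.NonZero k}} → k ℕ.< p → ⟨ p ⟩ ≈ 0# → ∃ λ a → ⟨ k ⟩ * a ≈ 1#
  ⟨⟩-invertible {p} {k} p-prime k<p ⟨p⟩≈0 with coprime-Bézout (prime⇒coprime p-prime k<p)
  ... | Bézout.-+ x y 1+xp≡yk = a , (begin
    ⟨ k ⟩ * a          ≈⟨ yk≈ka ⟨
    ⟨ y ℕ.* k ⟩        ≡⟨ ≡.cong ⟨_⟩ 1+xp≡yk ⟨
    1# + q * ⟨ x ℕ.* p ⟩ ≈⟨ +-congˡ (trans (*-congˡ (⟨*p⟩≈0 x)) (zeroʳ q)) ⟩
    1# + 0#            ≈⟨ +-identityʳ 1# ⟩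
    1#                 ∎)
    where
    a = proj₁ (⟨⟩-* y k)
    yk≈ka = proj₂ (⟨⟩-* y k)
    ⟨*p⟩≈0 : ∀ x → ⟨ x ℕ.* p ⟩ ≈ 0#
    ⟨*p⟩≈0 x = trans (proj₂ (⟨⟩-* x p)) (trans (*-congʳ ⟨p⟩≈0) (zeroˡ _))
  -- With this sign 0 = [xp] = 1 + q [yk], hence the factor - q in the inverse.
  ... | Bézout.+- x y 1+yk≡xp = - (q * a) , sym (trans (+-inverseˡ-unique 1# (⟨ k ⟩ * (q * a)) (begin
    1# + ⟨ k ⟩ * (q * a)   ≈⟨ +-congˡ (x∙yz≈y∙xz _ _ _) ⟩
    1# + q * (⟨ k ⟩ * a)   ≈⟨ +-congˡ (*-congˡ yk≈ka) ⟨
    ⟨ suc (y ℕ.* k) ⟩      ≡⟨ ≡.cong ⟨_⟩ 1+yk≡xp ⟩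
    ⟨ x ℕ.* p ⟩            ≈⟨ trans (proj₂ (⟨⟩-* x p)) (trans (*-congʳ ⟨p⟩≈0) (zeroˡ _)) ⟩
    0#                     ∎)) (-‿distribʳ-* _ _))
    where
    a = proj₁ (⟨⟩-* y k)
    yk≈ka = proj₂ (⟨⟩-* y k)

  -- Signed q-binomial coefficients

  -- e n k = (-1)ᵏ q^(k(k+1)/2) [n choose k]_q, the coefficients of ∏ (1 - qʲx) over 1 ≤ j ≤ n.
  e : ℕ → ℕ → Carrier
  e n       zero    = 1#
  e zero    (suc k) = 0#
  e (suc n) (suc k) = e n (suc k) - q ^ suc n * e n k

  e-vanishes : ∀ {n k} → n ℕ.< k → e n k ≈ 0#
  e-vanishes {zero}  {suc k} n<k       = refl
  e-vanishes {suc n} {suc k} (s≤s n<k) = begin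
    e n (suc k) - q ^ suc n * e n k
      ≈⟨ +-cong (e-vanishes (ℕ.m<n⇒m<1+n n<k)) (-‿cong (trans (*-congˡ (e-vanishes n<k)) (zeroʳ _))) ⟩
    0# - 0#                           ≈⟨ -‿inverseʳ 0# ⟩
    0#                                ∎

  e-pascal : ∀ n k → e (suc n) (suc k) + q ^ suc n * e n k ≈ e n (suc k)
  e-pascal n k = x-y+y≈x _ _

  -- The second Pascal rule: the product of 1 - qʲx over 1 ≤ j ≤ n + 1 is also (1 - qx) times the
  -- product for n evaluated at qx. The instance of `e-absorb` is a hypothesis because the induction
  -- that proves `e-absorb` calls this rule.
  e-pascal′-from : ∀ n k → ⟨ suc k ⟩ * e n k ≈ ⟨ suc n ⟩ * e n k + ⟨ suc k ⟩ * e n (suc k) →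
                   e (suc n) (suc k) + q ^ suc k * e n k ≈ q ^ suc k * e n (suc k)
  e-pascal′-from n k hyp = +-cancelʳ (q ^ suc n * e n k) _ _ (
    +-cancelʳ (⟨ suc n ⟩ * E + ⟨ suc k ⟩ * E + ⟨ suc k ⟩ * E₁) _ _ (begin
    (X + t * E + s * E) + (b * E + a * E + a * E₁)
      ≈⟨ solve 7 (λ X t E s b a E₁ → (X :+ t :* E :+ s :* E) :+ (b :* E :+ a :* E :+ a :* E₁) :=
                   (X :+ s :* E) :+ (a :+ t) :* E :+ (b :* E :+ a :* E₁)) refl X t E s b a E₁ ⟩
    (X + s * E) + (a + t) * E + (b * E + a * E₁)
      ≈⟨ +-cong (+-cong (e-pascal n k) (*-congʳ (sym (⟨⟩-suc (suc k))))) (sym hyp) ⟩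
    E₁ + (1# + q * a) * E + a * E
      ≈⟨ solve 5 (λ u q a E E₁ → E₁ :+ (u :+ q :* a) :* E :+ a :* E :=
                   q :* (a :* E) :+ (E₁ :+ u :* E :+ a :* E))
           refl 1# q a E E₁ ⟩
    q * (a * E) + (E₁ + 1# * E + a * E)
      ≈⟨ +-cong (*-congˡ hyp) (+-congʳ (+-cong (sym (*-identityˡ E₁)) refl)) ⟩
    q * (b * E + a * E₁) + (1# * E₁ + 1# * E + a * E)
      ≈⟨ solve 6 (λ u q a b E E₁ → q :* (b :* E :+ a :* E₁) :+ (u :* E₁ :+ u :* E :+ a :* E) :=
            (u :+ q :* b) :* E :+ (u :+ q :* a) :* E₁ :+ a :* E) refl 1# q a b E E₁ ⟩
    (1# + q * b) * E + (1# + q * a) * E₁ + a * E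
      -- The powers t and s come from the two expansions of a q-integer, [n + 2] = 1 + q [n + 1] =
      -- [n + 1] + qⁿ⁺¹, and likewise for [k + 2].
      ≈⟨ +-congʳ (+-cong (*-congʳ (⟨⟩-suc (suc n))) (*-congʳ (⟨⟩-suc (suc k)))) ⟩
    (b + s) * E + (a + t) * E₁ + a * E
      ≈⟨ solve 6 (λ a b s t E E₁ → (b :+ s) :* E :+ (a :+ t) :* E₁ :+ a :* E :=
            (t :* E₁ :+ s :* E) :+ (b :* E :+ a :* E :+ a :* E₁)) refl a b s t E E₁ ⟩
    (t * E₁ + s * E) + (b * E + a * E + a * E₁) ∎))
    where
    E = e n k
    E₁ = e n (suc k)
    X = e (suc n) (suc k)
    a = ⟨ suc k ⟩
    b = ⟨ suc n ⟩
    t = q ^ suc k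
    s = q ^ suc n

  -- This is the ratio of consecutive coefficients, [k + 1] e(n,k + 1) = - ([n + 1] - [k + 1])
  -- e(n,k), with the subtraction moved across; no truncated n - k appears, so it also covers k > n.
  e-absorb : ∀ n k → ⟨ suc k ⟩ * e n k ≈ ⟨ suc n ⟩ * e n k + ⟨ suc k ⟩ * e n (suc k)
  e-absorb zero    zero    = sym (trans (+-congˡ (zeroʳ _)) (+-identityʳ _))
  e-absorb zero    (suc k) = begin
    ⟨ 2 ℕ.+ k ⟩ * 0#                 ≈⟨ +-identityˡ _ ⟨
    0# + ⟨ 2 ℕ.+ k ⟩ * 0#            ≈⟨ +-congʳ (zeroʳ _) ⟨
    ⟨ 1 ⟩ * 0# + ⟨ 2 ℕ.+ k ⟩ * 0#    ∎
  e-absorb (suc n) zero    = +-cancelʳ (⟨ 1 ⟩ * (q ^ suc n * 1#)) _ _ (begin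
    ⟨ 1 ⟩ * 1# + ⟨ 1 ⟩ * (s * 1#)
      ≈⟨ +-cong (e-absorb n zero) refl ⟩
    b * 1# + ⟨ 1 ⟩ * B + ⟨ 1 ⟩ * (s * 1#)
      ≈⟨ +-cong (+-congˡ (*-congˡ (sym (e-pascal n zero)))) (trans (*-congʳ ⟨1⟩) (*-identityˡ _)) ⟩
    b * 1# + ⟨ 1 ⟩ * (X + s * 1#) + s * 1#
      ≈⟨ solve 5 (λ u b a X s → b :* u :+ a :* (X :+ s :* u) :+ s :* u := ((b :+ s) :* u :+ a :* X) :+ a :* (s :* u))
           refl 1# b ⟨ 1 ⟩ X s ⟩
    (b + s) * 1# + ⟨ 1 ⟩ * X + ⟨ 1 ⟩ * (s * 1#)
      ≈⟨ +-congʳ (+-congʳ (*-congʳ (⟨⟩-suc (suc n)))) ⟨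
    ⟨ suc (suc n) ⟩ * 1# + ⟨ 1 ⟩ * X + ⟨ 1 ⟩ * (s * 1#) ∎)
    where
    b = ⟨ suc n ⟩
    s = q ^ suc n
    B = e n 1
    X = e (suc n) 1
  e-absorb (suc n) (suc k) = +-cancelʳ (a′ * (s * A) + a′ * (s * B)) _ _ (begin
    a′ * X + (a′ * (s * A) + a′ * (s * B))
      ≈⟨ solve 5 (λ a′ X s A B → a′ :* X :+ (a′ :* (s :* A) :+ a′ :* (s :* B)) :=
                   a′ :* (X :+ s :* A) :+ a′ :* (s :* B))
           refl a′ X s A B ⟩
    a′ * (X + s * A) + a′ * (s * B)
      ≈⟨ +-cong (*-congˡ (e-pascal n k)) (*-congʳ (⟨⟩-suc (suc k))) ⟩
    a′ * B + (a + t) * (s * B)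
      ≈⟨ +-congʳ (e-absorb n (suc k)) ⟩
    (b * B + a′ * C) + (a + t) * (s * B)
      ≈⟨ +-congʳ (+-cong (*-congˡ (sym (e-pascal n k))) (*-congˡ (sym (e-pascal n (suc k))))) ⟩
    (b * (X + s * A) + a′ * (Y + s * B)) + (a + t) * (s * B)
      ≈⟨ solve 9 (λ b X s A a′ Y B a t → (b :* (X :+ s :* A) :+ a′ :* (Y :+ s :* B)) :+ (a :+ t) :* (s :* B) :=
           b :* X :+ s :* (b :* A :+ a :* B) :+ s :* (t :* B) :+ a′ :* (Y :+ s :* B)) refl b X s A a′ Y B a t ⟩
    b * X + s * (b * A + a * B) + s * (t * B) + a′ * (Y + s * B)
      ≈⟨ +-congʳ (+-cong (+-congˡ (*-congˡ (sym (e-absorb n k)))) (*-congˡ (sym (e-pascal′-from n k (e-absorb n k))))) ⟩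
    b * X + s * (a * A) + s * (X + t * A) + a′ * (Y + s * B)
      ≈⟨ solve 9 (λ b X s A a′ Y B a t → b :* X :+ s :* (a :* A) :+ s :* (X :+ t :* A) :+ a′ :* (Y :+ s :* B) :=
            (b :+ s) :* X :+ a′ :* Y :+ ((a :+ t) :* (s :* A) :+ a′ :* (s :* B))) refl b X s A a′ Y B a t ⟩
    (b + s) * X + a′ * Y + ((a + t) * (s * A) + a′ * (s * B))
      ≈⟨ +-cong (+-congʳ (*-congʳ (⟨⟩-suc (suc n)))) (+-congʳ (*-congʳ (⟨⟩-suc (suc k)))) ⟨
    ⟨ suc (suc n) ⟩ * X + a′ * Y + (a′ * (s * A) + a′ * (s * B)) ∎)
    where
    a = ⟨ suc k ⟩
    a′ = ⟨ suc (suc k) ⟩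
    b = ⟨ suc n ⟩
    s = q ^ suc n
    t = q ^ suc k
    A = e n k
    B = e n (suc k)
    C = e n (suc (suc k))
    X = e (suc n) (suc k)
    Y = e (suc n) (suc (suc k))

  e-pascal′ : ∀ n k → e (suc n) (suc k) + q ^ suc k * e n k ≈ q ^ suc k * e n (suc k)
  e-pascal′ n k = e-pascal′-from n k (e-absorb n k)

  -- The q-analogue of (k + 1) (n + 1 choose k + 1) = (n + 1) (n choose k): combine `e-absorb` with
  -- the second Pascal rule.
  e-symmetric-absorb : ∀ n k → ⟨ suc k ⟩ * e (suc n) (suc k) + q ^ suc k * (⟨ suc n ⟩ * e n k) ≈ 0#
  e-symmetric-absorb n k = +-cancelʳ (t * (a * B)) _ _ (begin
    (a * X + t * (b * A)) + t * (a * B)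
      ≈⟨ solve 6 (λ a X t b A B → (a :* X :+ t :* (b :* A)) :+ t :* (a :* B) :=
                   a :* X :+ t :* (b :* A :+ a :* B))
           refl a X t b A B ⟩
    a * X + t * (b * A + a * B)
      ≈⟨ +-congˡ (*-congˡ (sym (e-absorb n k))) ⟩
    a * X + t * (a * A)
      ≈⟨ solve 4 (λ a X t A → a :* X :+ t :* (a :* A) := a :* (X :+ t :* A)) refl a X t A ⟩
    a * (X + t * A)
      ≈⟨ *-congˡ (e-pascal′ n k) ⟩
    a * (t * B)
      ≈⟨ solve 3 (λ a t B → a :* (t :* B) := t :* (a :* B)) refl a t B ⟩
    t * (a * B)
      ≈⟨ +-identityˡ _ ⟨
    0# + t * (a * B) ∎)
    where
    a = ⟨ suc k ⟩
    b = ⟨ suc n ⟩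
    t = q ^ suc k
    A = e n k
    B = e n (suc k)
    X = e (suc n) (suc k)


  -- Telescoping sums over segments

  ι : Bool → Carrier
  ι b = if b then 1# else 0#

  open Sum semiring using (sum; sum-cong-≋; sum-replicate-zero; ∑-comm; *-distribˡ-sum; *-distribʳ-sum)

  -- The segment is cut out by a weight `ι`, so that sums always run over the whole of Fin n and
  -- double sums can be exchanged.
  telescope-below : ∀ {n} (u : ℕ → Carrier) (d : Fin n → Carrier) → (∀ i → u (suc (toℕ i)) ≈ u (toℕ i) + d i) →
                    ∀ {j} → j ℕ.≤ n → u 0 + sum (λ i → ι (toℕ i <ᵇ j) * d i) ≈ u j
  telescope-below {n} u d Δu {zero} z≤n = trans
     (+-congˡ (trans (sum-cong-≋ λ i → zeroˡ (d i)) (sum-replicate-zero n)))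
    (+-identityʳ (u 0))
  telescope-below {suc n} u d Δu {suc j} (s≤s j≤n) = begin
    u 0 + (1# * d zero + rest)   ≈⟨ +-assoc _ _ _ ⟨
    u 0 + 1# * d zero + rest     ≈⟨ +-congʳ (trans (+-congˡ (*-identityˡ _)) (sym (Δu zero))) ⟩
    u 1 + rest                   ≈⟨ telescope-below (u ∘ suc) (d ∘ suc) (Δu ∘ suc) j≤n ⟩
    u (suc j)                    ∎
    where rest = sum λ i → ι (toℕ i <ᵇ j) * d (suc i)

  telescope-above : ∀ {n} (u : ℕ → Carrier) (d : Fin n → Carrier) → (∀ i → u (suc (toℕ i)) ≈ u (toℕ i) + d i) →
                    ∀ {j} → j ℕ.≤ n → u j + sum (λ i → ι (j <ᵇ suc (toℕ i)) * d i) ≈ u n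
  telescope-above {zero} u d Δu {zero} z≤n = +-identityʳ (u 0)
  telescope-above {suc n} u d Δu {zero} z≤n = begin
    u 0 + (1# * d zero + rest)   ≈⟨ +-assoc _ _ _ ⟨
    u 0 + 1# * d zero + rest     ≈⟨ +-congʳ (trans (+-congˡ (*-identityˡ _)) (sym (Δu zero))) ⟩
    u 1 + rest                   ≈⟨ telescope-above (u ∘ suc) (d ∘ suc) (Δu ∘ suc) z≤n ⟩
    u (suc n)                    ∎
    where rest = sum λ (i : Fin n) → 1# * d (suc i)
  telescope-above {suc n} u d Δu {suc j} (s≤s j≤n) = begin
    u (suc j) + (0# * d zero + rest)   ≈⟨ +-congˡ (trans (+-congʳ (zeroˡ _)) (+-identityˡ _)) ⟩
    u (suc j) + rest                   ≈⟨ telescope-above (u ∘ suc) (d ∘ suc) (Δu ∘ suc) j≤n ⟩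
    u (suc n)                          ∎
    where rest = sum λ (i : Fin n) → ι (j <ᵇ suc (toℕ i)) * d (suc i)

  -- Dual pairs of functions on {1,...,N}

  module Duality (N : ℕ) (inv : Fin N → Carrier) (inv-inverse : ∀ i → ⟨ suc (toℕ i) ⟩ * inv i ≈ 1#)
                 (⟨1+N⟩≈0 : ⟨ suc N ⟩ ≈ 0#) where

    ∑ : (Fin N → Carrier) → Carrier
    ∑ f = sum f

    ∑-cong : ∀ {f g} → (∀ i → f i ≈ g i) → ∑ f ≈ ∑ g
    ∑-cong f≈g = sum-cong-≋ {N} f≈g

    *-distribˡ-∑ : ∀ x f → x * ∑ f ≈ ∑ (λ i → x * f i)
    *-distribˡ-∑ x f = *-distribˡ-sum x f

    *-distribʳ-∑ : ∀ x f → ∑ f * x ≈ ∑ (λ i → f i * x)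
    *-distribʳ-∑ x f = *-distribʳ-sum x f

    -- Since [N + 1] = 0, `e-absorb` becomes [k + 1] e(N,k) = [k + 1] e(N,k + 1); cancelling the
    -- unit [k + 1] makes the row constant, starting from e(N,0) = 1.
    e-top : ∀ {k} → k ℕ.≤ N → e N k ≈ 1#
    e-top {zero}  _   = refl
    e-top {suc k} k<N = trans (sym (begin
      e N k                                                      ≈⟨ cancel (e N k) ⟨
      v * (⟨ suc k ⟩ * e N k)                                    ≈⟨ *-congˡ (e-absorb N k) ⟩
      v * (⟨ suc N ⟩ * e N k + ⟨ suc k ⟩ * e N (suc k))
        ≈⟨ *-congˡ (+-congʳ (trans (*-congʳ ⟨1+N⟩≈0) (zeroˡ _))) ⟩
      v * (0# + ⟨ suc k ⟩ * e N (suc k))                         ≈⟨ *-congˡ (+-identityˡ _) ⟩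
      v * (⟨ suc k ⟩ * e N (suc k))                              ≈⟨ cancel (e N (suc k)) ⟩
      e N (suc k)                                                ∎)) (e-top (ℕ.<⇒≤ k<N))
      where
      v = inv (fromℕ< k<N)
      v⟨⟩≈1 : v * ⟨ suc k ⟩ ≈ 1#
      v⟨⟩≈1 = begin
        v * ⟨ suc k ⟩                        ≡⟨ ≡.cong (λ i → v * ⟨ suc i ⟩) (Fin.toℕ-fromℕ< k<N) ⟨
        v * ⟨ suc (toℕ (fromℕ< k<N)) ⟩       ≈⟨ *-comm _ _ ⟩
        ⟨ suc (toℕ (fromℕ< k<N)) ⟩ * v       ≈⟨ inv-inverse (fromℕ< k<N) ⟩
        1#                                   ∎
      cancel : ∀ x → v * (⟨ suc k ⟩ * x) ≈ x
      cancel x = trans (sym (*-assoc _ _ _)) (trans (*-congʳ v⟨⟩≈1) (*-identityˡ x))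

    -- The difference e (m + 1) (k + 1) - e m (k + 1): both arguments are one
    -- less than the indices in {1,…,N} they stand for.
    d : ℕ → ℕ → Carrier
    d m k = - (q ^ suc m * e m k)

    ratio : Fin N → Carrier
    ratio j = q ^ suc (toℕ j) * inv j

    -- `e-symmetric-absorb` divided by [j + 1] [k + 1]. Summing it over j telescopes to the first
    -- intertwining identity.
    ratio-d : ∀ j k → e (suc (toℕ j)) (suc (toℕ k)) * ratio j ≈ ratio k * d (toℕ j) (toℕ k)
    ratio-d j k = trans (+-inverseˡ-unique _ _ (begin
      X * (s * y) + (t * x) * (s * A)
        ≈⟨ +-cong (sym (trans (*-congʳ (inv-inverse k)) (*-identityˡ _)))
                 (sym (trans (*-congʳ (inv-inverse j)) (*-identityˡ _))) ⟩
      (a * x) * (X * (s * y)) + (b * y) * ((t * x) * (s * A))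
        ≈⟨ solve 8 (λ a x X s y b t A → (a :* x) :* (X :* (s :* y)) :+ (b :* y) :* ((t :* x) :* (s :* A)) :=
             (x :* s :* y) :* (a :* X :+ t :* (b :* A))) refl a x X s y b t A ⟩
      (x * s * y) * (a * X + t * (b * A))
        ≈⟨ *-congˡ (e-symmetric-absorb (toℕ j) (toℕ k)) ⟩
      (x * s * y) * 0#
        ≈⟨ zeroʳ _ ⟩
      0# ∎)) (-‿distribʳ-* _ _)
      where
      a = ⟨ suc (toℕ k) ⟩
      b = ⟨ suc (toℕ j) ⟩
      t = q ^ suc (toℕ k)
      s = q ^ suc (toℕ j)
      x = inv k
      y = inv j
      A = e (toℕ j) (toℕ k)
      X = e (suc (toℕ j)) (suc (toℕ k))

    -- `e-absorb` divided by [m + 1] [k + 1]. It exhibits the terms of the second intertwining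
    -- identity as increments in k.
    inv-d : ∀ m k → ratio m * e (toℕ m) (suc (toℕ k)) ≈
                    ratio m * e (toℕ m) (toℕ k) + inv k * d (toℕ m) (toℕ k)
    inv-d m k = +-cancelʳ (x * (s * A)) _ _ (begin
      (s * y) * B + x * (s * A)
        ≈⟨ +-cong (sym (trans (*-congʳ (inv-inverse k)) (*-identityˡ _)))
                 (sym (trans (*-congʳ (inv-inverse m)) (*-identityˡ _))) ⟩
      (a * x) * ((s * y) * B) + (b * y) * (x * (s * A))
        ≈⟨ solve 7 (λ a x s y B b A → (a :* x) :* ((s :* y) :* B) :+ (b :* y) :* (x :* (s :* A)) :=
             (x :* s :* y) :* (b :* A :+ a :* B)) refl a x s y B b A ⟩
      (x * s * y) * (b * A + a * B)
        ≈⟨ *-congˡ (e-absorb (toℕ m) (toℕ k)) ⟨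
      (x * s * y) * (a * A)
        ≈⟨ solve 5 (λ x s y a A → (x :* s :* y) :* (a :* A) := (a :* x) :* ((s :* y) :* A)) refl x s y a A ⟩
      (a * x) * ((s * y) * A)
        ≈⟨ trans (*-congʳ (inv-inverse k)) (*-identityˡ _) ⟩
      (s * y) * A
        ≈⟨ x-y+y≈x _ (x * (s * A)) ⟨
      (s * y) * A - x * (s * A) + x * (s * A)
        ≈⟨ +-assoc _ _ _ ⟩
      (s * y) * A + (- (x * (s * A)) + x * (s * A))
        ≈⟨ +-congˡ (+-congʳ (-‿distribʳ-* _ _)) ⟩
      (s * y) * A + (x * - (s * A) + x * (s * A))
        ≈⟨ +-assoc _ _ _ ⟨
      (s * y) * A + x * - (s * A) + x * (s * A) ∎)
      where
      a = ⟨ suc (toℕ k) ⟩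
      b = ⟨ suc (toℕ m) ⟩
      s = q ^ suc (toℕ m)
      x = inv k
      y = inv m
      A = e (toℕ m) (toℕ k)
      B = e (toℕ m) (suc (toℕ k))

    -- Sums over {j | i < ⟦ j ⟧ + δ}, so that δ = 0 and δ = 1 give the strict
    -- and the weak inequality i < ⟦ j ⟧ and i ≤ ⟦ j ⟧.
    sumFrom : ℕ → (Fin N → Carrier) → ℕ → Carrier
    sumFrom δ h i = ∑ λ j → ι (i <ᵇ suc (toℕ j) ℕ.+ δ) * h j

    sumFrom-cong : ∀ δ {f g} → (∀ j → f j ≈ g j) → ∀ i → sumFrom δ f i ≈ sumFrom δ g i
    sumFrom-cong δ f≈g i = ∑-cong λ j → *-congˡ (f≈g j)

    sumFrom-scale : ∀ δ c h i → c * sumFrom δ h i ≈ sumFrom δ (λ j → c * h j) i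
    sumFrom-scale δ c h i = trans (*-distribˡ-∑ c _) (∑-cong λ j → x∙yz≈y∙xz _ _ _)

    -- Summation by parts: after exchanging the sums, the increments `d` with m < j + δ add up to a
    -- single value of `e`.
    sum-d-sumFrom : ∀ {δ} → δ ℕ.≤ 1 → ∀ h k → ∑ (λ m → d (toℕ m) k * sumFrom δ h (suc (toℕ m))) ≈
                    ∑ (λ j → e (toℕ j ℕ.+ δ) (suc k) * h j)
    sum-d-sumFrom {δ} δ≤1 h k = begin
      ∑ (λ m → d (toℕ m) k * sumFrom δ h (suc (toℕ m)))
        ≈⟨ ∑-cong (λ m → *-distribˡ-∑ _ _) ⟩
      ∑ (λ m → ∑ λ j → d (toℕ m) k * (ι (toℕ m <ᵇ toℕ j ℕ.+ δ) * h j))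
        ≈⟨ ∑-comm {N} {N} _ ⟩
      ∑ (λ j → ∑ λ m → d (toℕ m) k * (ι (toℕ m <ᵇ toℕ j ℕ.+ δ) * h j))
        ≈⟨ ∑-cong (λ j → ∑-cong λ m → trans (x∙yz≈y∙xz _ _ _) (sym (*-assoc _ _ _))) ⟩
      ∑ (λ j → ∑ λ m → ι (toℕ m <ᵇ toℕ j ℕ.+ δ) * d (toℕ m) k * h j)
        ≈⟨ ∑-cong (λ j → sym (*-distribʳ-∑ (h j) (λ m → ι (toℕ m <ᵇ toℕ j ℕ.+ δ) * d (toℕ m) k))) ⟩
      ∑ (λ j → ∑ (λ m → ι (toℕ m <ᵇ toℕ j ℕ.+ δ) * d (toℕ m) k) * h j)
        -- The telescoped sum starts at e(0,k + 1), which is 0 by definition; δ ≤ 1 keeps its end j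
        -- + δ within N.
        ≈⟨ ∑-cong (λ j → *-congʳ (trans (sym (+-identityˡ _))
             (telescope-below {N} (λ n → e n (suc k)) (λ m → d (toℕ m) k) (λ _ → refl) (bound j)))) ⟩
      ∑ (λ j → e (toℕ j ℕ.+ δ) (suc k) * h j) ∎
      where
      bound : ∀ j → toℕ j ℕ.+ δ ℕ.≤ N
      bound j = ℕ.≤-trans (ℕ.+-monoʳ-≤ (toℕ j) δ≤1) (≡.subst (ℕ._≤ N) (ℕ.+-comm 1 (toℕ j)) (Fin.toℕ<n j))

    -- For indices counted from 1 the kernel is e(m,k) - e(m-1,k). The inner sums of the two sides
    -- of the theorem, as functions of the index that bounds them, will form such a pair up to sign.
    Dual : (f g : Fin N → Carrier) → Set ℓ
    Dual f g = ∀ k → f k ≈ ∑ λ m → d (toℕ m) (toℕ k) * g m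

    Dual-cong : ∀ {f f′ g g′} → (∀ k → f k ≈ f′ k) → (∀ m → g m ≈ g′ m) → Dual f g → Dual f′ g′
    Dual-cong f≈f′ g≈g′ dual k = trans (sym (f≈f′ k)) (trans (dual k) (∑-cong λ m → *-congˡ (g≈g′ m)))

    -- The increments telescope to e(N,k) - e(0,k) = 1; `⟨1+N⟩≈0` enters here.
    dual-1 : Dual (λ _ → 1#) (λ _ → 1#)
    dual-1 k = begin
      1#                                              ≈⟨ e-top (Fin.toℕ<n k) ⟨
      e N (suc (toℕ k))
        ≈⟨ telescope-above {N} (λ n → e n (suc (toℕ k))) (λ m → d (toℕ m) (toℕ k)) (λ _ → refl) z≤n ⟨
      0# + ∑ (λ (m : Fin N) → 1# * d (toℕ m) (toℕ k)) ≈⟨ +-identityˡ _ ⟩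
      ∑ (λ (m : Fin N) → 1# * d (toℕ m) (toℕ k))    ≈⟨ ∑-cong (λ m → *-comm _ _) ⟩
      ∑ (λ (m : Fin N) → d (toℕ m) (toℕ k) * 1#)    ∎

    -- `ratio-d` turns the increment into a value of `e` with first argument j + 1, and summation by
    -- parts with δ = 1 turns that value back into increments.
    dual-weak : ∀ {f g} → Dual f g →
                Dual (λ k → ratio k * f k) (λ m → sumFrom 1 (λ j → ratio j * g j) (suc (toℕ m)))
    dual-weak {f} {g} dual k = begin
      ratio k * f k                                                    ≈⟨ *-congˡ (dual k) ⟩
      ratio k * ∑ (λ j → d (toℕ j) (toℕ k) * g j)                    ≈⟨ *-distribˡ-∑ (ratio k) _ ⟩
      ∑ (λ j → ratio k * (d (toℕ j) (toℕ k) * g j))                  ≈⟨ ∑-cong (λ j → begin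
        ratio k * (d (toℕ j) (toℕ k) * g j)                              ≈⟨ *-assoc _ _ _ ⟨
        ratio k * d (toℕ j) (toℕ k) * g j                                ≈⟨ *-congʳ (ratio-d j k) ⟨
        e (suc (toℕ j)) (suc (toℕ k)) * ratio j * g j                    ≈⟨ *-assoc _ _ _ ⟩
        e (suc (toℕ j)) (suc (toℕ k)) * (ratio j * g j)
          ≡⟨ ≡.cong (λ i → e i (suc (toℕ k)) * (ratio j * g j)) (ℕ.+-comm 1 (toℕ j)) ⟩
        e (toℕ j ℕ.+ 1) (suc (toℕ k)) * (ratio j * g j)                  ∎) ⟩
      ∑ (λ j → e (toℕ j ℕ.+ 1) (suc (toℕ k)) * (ratio j * g j))
        ≈⟨ sum-d-sumFrom ℕ.≤-refl (λ j → ratio j * g j) (toℕ k) ⟨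
      ∑ (λ m → d (toℕ m) (toℕ k) * sumFrom 1 (λ j → ratio j * g j) (suc (toℕ m))) ∎

    -- Exchange the sums and telescope in k by `inv-d`. Allowing i = 0 covers the outermost sum,
    -- which has no preceding index.
    sumFrom-dual : ∀ {f g} → Dual f g → ∀ {i} → i ℕ.≤ N →
                   sumFrom 0 (λ k → inv k * f k) i ≈ ∑ (λ m → - e (toℕ m) i * (ratio m * g m))
    sumFrom-dual {f} {g} dual {i} i≤N = begin
      ∑ (λ k → ι (lt k) * (inv k * f k))
        ≈⟨ ∑-cong (λ k → *-congˡ (*-congˡ (dual k))) ⟩
      ∑ (λ k → ι (lt k) * (inv k * ∑ (λ m → d (toℕ m) (toℕ k) * g m)))
        ≈⟨ ∑-cong (λ k → trans (sym (*-assoc _ _ _)) (*-distribˡ-∑ _ _)) ⟩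
      ∑ (λ k → ∑ λ m → ι (lt k) * inv k * (d (toℕ m) (toℕ k) * g m))
        ≈⟨ ∑-comm {N} {N} _ ⟩
      ∑ (λ m → ∑ λ k → ι (lt k) * inv k * (d (toℕ m) (toℕ k) * g m))
        ≈⟨ ∑-cong (λ m → trans (∑-cong λ k → trans (sym (*-assoc _ _ _)) (*-congʳ (*-assoc _ _ _)))
             (sym (*-distribʳ-∑ (g m) (λ k → ι (lt k) * (inv k * d (toℕ m) (toℕ k)))))) ⟩
      ∑ (λ m → ∑ (λ k → ι (lt k) * (inv k * d (toℕ m) (toℕ k))) * g m)
        ≈⟨ ∑-cong (λ m → trans (*-congʳ (inner m)) (*-assoc _ _ _)) ⟩
      ∑ (λ m → - e (toℕ m) i * (ratio m * g m)) ∎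
      where
      lt : Fin N → Bool
      lt k = i <ᵇ suc (toℕ k) ℕ.+ 0
      inner : ∀ m → ∑ (λ k → ι (lt k) * (inv k * d (toℕ m) (toℕ k))) ≈ - e (toℕ m) i * ratio m
      inner m = begin
        ∑ (λ k → ι (lt k) * (inv k * d (toℕ m) (toℕ k)))
          ≈⟨ ∑-cong (λ k → *-congʳ (reflexive (≡.cong (λ j → ι (i <ᵇ suc j)) (ℕ.+-identityʳ (toℕ k))))) ⟩
        S
          ≈⟨ +-inverseˡ-unique _ _ (trans (+-comm _ _) (begin
            ratio m * e (toℕ m) i + S
              ≈⟨ telescope-above (λ k → ratio m * e (toℕ m) k) (λ k → inv k * d (toℕ m) (toℕ k)) (inv-d m) i≤N ⟩
            ratio m * e (toℕ m) N
              -- The upper boundary term vanishes because m < N; only the lower one, at i, survives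
              -- and carries the minus sign.
              ≈⟨ trans (*-congˡ (e-vanishes (Fin.toℕ<n m))) (zeroʳ _) ⟩
            0# ∎)) ⟩
        - (ratio m * e (toℕ m) i)
          ≈⟨ -‿cong (*-comm _ _) ⟩
        - (e (toℕ m) i * ratio m)
          ≈⟨ -‿distribˡ-* _ _ ⟩
        - e (toℕ m) i * ratio m ∎
        where S = ∑ λ k → ι (i <ᵇ suc (toℕ k)) * (inv k * d (toℕ m) (toℕ k))

    -- Here `sumFrom-dual` gives a value of `e` with first argument j, so summation by parts applies
    -- with δ = 0: the new inequality is strict.
    dual-strict : ∀ {f g} → Dual f g →
                  Dual (λ k → sumFrom 0 (λ i → inv i * f i) (suc (toℕ k)))
                       (λ m → - 1# * sumFrom 0 (λ j → ratio j * g j) (suc (toℕ m)))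
    dual-strict {f} {g} dual k = begin
      sumFrom 0 (λ i → inv i * f i) (suc (toℕ k))
        ≈⟨ sumFrom-dual dual (Fin.toℕ<n k) ⟩
      ∑ (λ j → - e (toℕ j) (suc (toℕ k)) * (ratio j * g j))
        ≈⟨ ∑-cong (λ j → trans (sym (-‿distribˡ-* _ _)) (sym (-1*x≈-x _))) ⟩
      ∑ (λ j → - 1# * (e (toℕ j) (suc (toℕ k)) * (ratio j * g j)))
        ≈⟨ *-distribˡ-∑ (- 1#) _ ⟨
      - 1# * ∑ (λ j → e (toℕ j) (suc (toℕ k)) * (ratio j * g j))
        ≈⟨ *-congˡ (∑-cong λ j → *-congʳ (reflexive (≡.cong (λ i → e i (suc (toℕ k))) (≡.sym (ℕ.+-identityʳ (toℕ j)))))) ⟩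
      - 1# * ∑ (λ j → e (toℕ j ℕ.+ 0) (suc (toℕ k)) * (ratio j * g j))
        ≈⟨ *-congˡ (sum-d-sumFrom z≤n (λ j → ratio j * g j) (toℕ k)) ⟨
      - 1# * ∑ (λ m → d (toℕ m) (toℕ k) * sumFrom 0 (λ j → ratio j * g j) (suc (toℕ m)))
        ≈⟨ *-distribˡ-∑ (- 1#) _ ⟩
      ∑ (λ m → - 1# * (d (toℕ m) (toℕ k) * sumFrom 0 (λ j → ratio j * g j) (suc (toℕ m))))
        ≈⟨ ∑-cong (λ m → x∙yz≈y∙xz _ _ _) ⟩
      ∑ (λ m → d (toℕ m) (toℕ k) * (- 1# * sumFrom 0 (λ j → ratio j * g j) (suc (toℕ m)))) ∎

    sumFrom-dual-0 : ∀ {f g} → Dual f g →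
                     sumFrom 0 (λ k → inv k * f k) 0 ≈ - 1# * sumFrom 0 (λ j → ratio j * g j) 0
    sumFrom-dual-0 {f} {g} dual = begin
      sumFrom 0 (λ k → inv k * f k) 0           ≈⟨ sumFrom-dual dual z≤n ⟩
      -- At i = 0 the kernel is e(m,0) = 1, so the weight disappears.
      ∑ (λ j → - 1# * (ratio j * g j))        ≈⟨ *-distribˡ-∑ (- 1#) _ ⟨
      - 1# * ∑ (λ j → ratio j * g j)          ≈⟨ *-congˡ (∑-cong λ j → *-identityˡ _) ⟨
      - 1# * ∑ (λ j → 1# * (ratio j * g j))   ∎

    -- Iterated sums with prescribed slacks

    nest : ∀ {l} → Vec ℕ l → (Fin l → Fin N → Carrier) → ℕ → Carrier
    nest []       w i = 1#
    nest (δ ∷ δs) w i = sumFrom δ (λ j → w zero j * nest δs (w ∘ suc) ⟦ j ⟧) i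

    harmonicWeight : ∀ {l} → Vec ℕ l → Fin l → Fin N → Carrier
    harmonicWeight s a k = q ^ ((lookup s a ∸ 1) ℕ.* ⟦ k ⟧) * inv k ^ lookup s a

    -- Equal to `ratio`; the power 1 is kept to match the residue of the summand in the theorem.
    dualWeight : ∀ {w} → Fin w → Fin N → Carrier
    dualWeight _ j = q ^ ⟦ j ⟧ * inv j ^ 1

    ratio-scale : ∀ δ {w} c (δs : Vec ℕ w) i →
                  sumFrom δ (λ j → ratio j * (c * nest δs dualWeight ⟦ j ⟧)) i ≈ c * nest (δ ∷ δs) dualWeight i
    ratio-scale δ c δs i = begin
      sumFrom δ (λ j → ratio j * (c * nest δs dualWeight ⟦ j ⟧)) i
        ≈⟨ sumFrom-cong δ (λ j → trans (x∙yz≈y∙xz _ _ _) (*-congˡ (*-congʳ (*-congˡ (sym (*-identityʳ _)))))) i ⟩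
      sumFrom δ (λ j → c * (dualWeight {1} zero j * nest δs dualWeight ⟦ j ⟧)) i
        ≈⟨ sumFrom-scale δ c (λ j → dualWeight {1} zero j * nest δs dualWeight ⟦ j ⟧) i ⟨
      c * nest (δ ∷ δs) dualWeight i ∎

    -- Covers all but one factor of an exponent t + 1, by the splitting qᵗᵏ/[k]ᵗ⁺¹ = (1/[k])
    -- (qᵏ/[k])ᵗ. The factor 1/[k] is treated afterwards, hence further out, so each block opens
    -- with its strict index. The constant c carries the accumulated sign.
    dual-weak-power : ∀ t {w} c (δs : Vec ℕ w) {f} → Dual f (λ m → c * nest δs dualWeight ⟦ m ⟧) →
                      Dual (λ k → q ^ (t ℕ.* ⟦ k ⟧) * inv k ^ t * f k)
                           (λ m → c * nest (replicate t 1 ++ δs) dualWeight ⟦ m ⟧)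
    dual-weak-power zero    c δs dual =
      Dual-cong (λ k → sym (trans (*-congʳ (*-identityˡ 1#)) (*-identityˡ _))) (λ m → refl) dual
    dual-weak-power (suc t) c δs {f} dual = Dual-cong
      (λ k → begin
        ratio k * (q ^ (t ℕ.* ⟦ k ⟧) * inv k ^ t * f k)
          ≈⟨ trans (sym (*-assoc _ _ _)) (*-congʳ (interchange _ _ _ _)) ⟩
        (q ^ ⟦ k ⟧ * q ^ (t ℕ.* ⟦ k ⟧)) * (inv k * inv k ^ t) * f k
          ≈⟨ *-congʳ (*-congʳ (^-homo-* q ⟦ k ⟧ (t ℕ.* ⟦ k ⟧))) ⟨
        q ^ (suc t ℕ.* ⟦ k ⟧) * inv k ^ suc t * f k ∎)
      (λ m → ratio-scale 1 c (replicate t 1 ++ δs) ⟦ m ⟧)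
      (dual-weak (dual-weak-power t c δs dual))

    nest-strict : ∀ {l} t (s : Vec ℕ l) i →
                  sumFrom 0 (λ k → inv k * (q ^ (t ℕ.* ⟦ k ⟧) * inv k ^ t * nest (replicate l 0) (harmonicWeight s) ⟦ k ⟧)) i ≈
                  nest (replicate (suc l) 0) (harmonicWeight (suc t ∷ s)) i
    nest-strict t s i = sumFrom-cong 0 (λ k → trans (sym (*-assoc _ _ _)) (*-congʳ (x∙yz≈y∙xz _ _ _))) i

    neg-ratio-scale : ∀ {l w} (δs : Vec ℕ w) i →
                      - 1# * sumFrom 0 (λ j → ratio j * ((- 1#) ^ l * nest δs dualWeight ⟦ j ⟧)) i ≈
                      (- 1#) ^ suc l * nest (0 ∷ δs) dualWeight i
    neg-ratio-scale {l} δs i = trans (*-congˡ (ratio-scale 0 ((- 1#) ^ l) δs i)) (sym (*-assoc _ _ _))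

    nest-dual : ∀ {l} (s : Vec ℕ l) → All (1 ≤_) s →
                Dual (λ k → nest (replicate l 0) (harmonicWeight s) ⟦ k ⟧)
                     (λ m → (- 1#) ^ l * nest (slacks s) dualWeight ⟦ m ⟧)
    nest-dual []                      []          = Dual-cong (λ k → refl) (λ m → sym (*-identityˡ 1#)) dual-1
    nest-dual {suc l} (suc t ∷ s) (_ ∷ s≥1)   = Dual-cong
      (λ k → nest-strict t s ⟦ k ⟧)
      (λ m → neg-ratio-scale {l} (replicate t 1 ++ slacks s) ⟦ m ⟧)
      (dual-strict (dual-weak-power t ((- 1#) ^ l) (slacks s) (nest-dual s s≥1)))

    -- The first exponent is split off from `nest-dual`: its sum starts at 0 and is a number, so
    -- `sumFrom-dual-0` replaces `dual-strict`.
    nest-duality : ∀ {l} (s : Vec ℕ l) → All (1 ≤_) s →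
                   nest (replicate l 0) (harmonicWeight s) 0 ≈ (- 1#) ^ l * nest (slacks s) dualWeight 0
    nest-duality []          []        = sym (*-identityˡ 1#)
    nest-duality {suc l} (suc t ∷ s) (_ ∷ s≥1) = begin
      nest (replicate (suc l) 0) (harmonicWeight (suc t ∷ s)) 0
        ≈⟨ nest-strict t s 0 ⟨
      sumFrom 0 (λ k → inv k * (q ^ (t ℕ.* ⟦ k ⟧) * inv k ^ t * nest (replicate l 0) (harmonicWeight s) ⟦ k ⟧)) 0
        ≈⟨ sumFrom-dual-0 (dual-weak-power t ((- 1#) ^ l) (slacks s) (nest-dual s s≥1)) ⟩
      - 1# * sumFrom 0 (λ j → ratio j * ((- 1#) ^ l * nest (replicate t 1 ++ slacks s) dualWeight ⟦ j ⟧)) 0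
        ≈⟨ neg-ratio-scale {l} (replicate t 1 ++ slacks s) 0 ⟩
      (- 1#) ^ suc l * nest (slacks (suc t ∷ s)) dualWeight 0 ∎

    -- From sums over filtered lists of tuples to iterated sums

    ∑ₗ ∏ₗ : ∀ {a} {A : Set a} → List A → (A → Carrier) → Carrier
    ∑ₗ xs f = List.foldr (λ x → f x +_) 0# xs
    ∏ₗ xs f = List.foldr (λ x → f x *_) 1# xs

    ∑ₗ-cong : ∀ {a} {A : Set a} (xs : List A) {f g} → (∀ x → f x ≈ g x) → ∑ₗ xs f ≈ ∑ₗ xs g
    ∑ₗ-cong []       f≈g = refl
    ∑ₗ-cong (x ∷ xs) f≈g = +-cong (f≈g x) (∑ₗ-cong xs f≈g)

    ∑ₗ-++ : ∀ {a} {A : Set a} (xs ys : List A) f → ∑ₗ (xs List.++ ys) f ≈ ∑ₗ xs f + ∑ₗ ys f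
    ∑ₗ-++ []       ys f = sym (+-identityˡ _)
    ∑ₗ-++ (x ∷ xs) ys f = trans (+-congˡ (∑ₗ-++ xs ys f)) (sym (+-assoc _ _ _))

    ∑ₗ-map : ∀ {a b} {A : Set a} {B : Set b} (g : A → B) xs f → ∑ₗ (List.map g xs) f ≡ ∑ₗ xs (f ∘ g)
    ∑ₗ-map g []       f = ≡.refl
    ∑ₗ-map g (x ∷ xs) f = ≡.cong (f (g x) +_) (∑ₗ-map g xs f)

    ∑ₗ-cartesianProductWith : ∀ {a b c} {A : Set a} {B : Set b} {C : Set c} (g : A → B → C) xs ys f →
                              ∑ₗ (cartesianProductWith g xs ys) f ≈ ∑ₗ xs λ x → ∑ₗ ys λ y → f (g x y)
    ∑ₗ-cartesianProductWith g []       ys f = refl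
    ∑ₗ-cartesianProductWith g (x ∷ xs) ys f =
      trans (∑ₗ-++ (List.map (g x) ys) _ f)
            (+-cong (reflexive (∑ₗ-map (g x) ys f)) (∑ₗ-cartesianProductWith g xs ys f))

    ∑ₗ-filter : ∀ {a p} {A : Set a} {P : A → Set p} (P? : Decidable P) xs f →
                ∑ₗ (List.filter P? xs) f ≈ ∑ₗ xs λ x → ι (does (P? x)) * f x
    ∑ₗ-filter P? []       f = refl
    ∑ₗ-filter P? (x ∷ xs) f with does (P? x)
    ... | true  = +-cong (sym (*-identityˡ _)) (∑ₗ-filter P? xs f)
    ... | false = trans (∑ₗ-filter P? xs f) (sym (trans (+-congʳ (zeroˡ _)) (+-identityˡ _)))

    ∑ₗ-scale : ∀ {a} {A : Set a} x (ys : List A) f → ∑ₗ ys (λ y → x * f y) ≈ x * ∑ₗ ys f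
    ∑ₗ-scale x []       f = sym (zeroʳ x)
    ∑ₗ-scale x (y ∷ ys) f = trans (+-congˡ (∑ₗ-scale x ys f)) (sym (distribˡ _ _ _))

    ∑ₗ-tabulate : ∀ {a} {A : Set a} {n} (h : Fin n → A) f → ∑ₗ (List.tabulate h) f ≡ sum (f ∘ h)
    ∑ₗ-tabulate {n = zero}  h f = ≡.refl
    ∑ₗ-tabulate {n = suc n} h f = ≡.cong (f (h zero) +_) (∑ₗ-tabulate (h ∘ suc) f)

    ∏ₗ-tabulate : ∀ {a} {A : Set a} {n} (h : Fin n → A) f → ∏ₗ (List.tabulate h) f ≡ ∏ₗ (allFin n) (f ∘ h)
    ∏ₗ-tabulate {n = zero}  h f = ≡.refl
    ∏ₗ-tabulate {n = suc n} h f = ≡.cong (f (h zero) *_)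
      (≡.trans (∏ₗ-tabulate (h ∘ suc) f) (≡.sym (∏ₗ-tabulate suc (f ∘ h))))

    ι-∧ : ∀ b c → ι (b ∧ c) ≈ ι b * ι c
    ι-∧ true  c = sym (*-identityˡ _)
    ι-∧ false c = sym (zeroˡ _)

    -- The decision of `Chain` on x ∷ v is a conjunction, so its indicator factors: one part depends
    -- on x alone, the other is a chain condition on v that starts from ⟦ x ⟧.
    ∑ₗ-chain : ∀ {l} (δs : Vec ℕ l) (w : Fin l → Fin N → Carrier) i →
               ∑ₗ (tuples N l) (λ v → ι (does (chain? δs i v)) * ∏ₗ (allFin l) (λ a → w a (lookup v a))) ≈
               nest δs w i
    ∑ₗ-chain []       w i = trans (+-identityʳ _) (*-identityˡ 1#)
    ∑ₗ-chain {suc l} (δ ∷ δs) w i = begin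
      ∑ₗ (tuples N (suc l)) (λ v → ι (does (chain? (δ ∷ δs) i v)) * ∏ₗ (allFin (suc l)) (λ a → w a (lookup v a)))
        ≈⟨ ∑ₗ-cartesianProductWith _∷_ (allFin N) (tuples N l) _ ⟩
      ∑ₗ (allFin N) (λ x → ∑ₗ (tuples N l) λ v →
        ι (does (chain? (δ ∷ δs) i (x ∷ v))) * ∏ₗ (allFin (suc l)) (λ a → w a (lookup (x ∷ v) a)))
        ≈⟨ ∑ₗ-cong (allFin N) (λ x → ∑ₗ-cong (tuples N l) λ v → begin
          ι (does (chain? (δ ∷ δs) i (x ∷ v))) * ∏ₗ (allFin (suc l)) (λ a → w a (lookup (x ∷ v) a))
            ≈⟨ *-cong (ι-∧ _ (does (chain? δs ⟦ x ⟧ v)))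
                     (*-congˡ (reflexive (∏ₗ-tabulate suc (λ a → w a (lookup (x ∷ v) a))))) ⟩
          ι (i <ᵇ ⟦ x ⟧ ℕ.+ δ) * ι (does (chain? δs ⟦ x ⟧ v)) *
            (w zero x * ∏ₗ (allFin l) (λ a → w (suc a) (lookup v a)))
            ≈⟨ interchange _ _ _ _ ⟩
          ι (i <ᵇ ⟦ x ⟧ ℕ.+ δ) * w zero x *
            (ι (does (chain? δs ⟦ x ⟧ v)) * ∏ₗ (allFin l) (λ a → w (suc a) (lookup v a))) ∎) ⟩
      ∑ₗ (allFin N) (λ x → ∑ₗ (tuples N l) λ v →
        ι (i <ᵇ ⟦ x ⟧ ℕ.+ δ) * w zero x *
            (ι (does (chain? δs ⟦ x ⟧ v)) * ∏ₗ (allFin l) (λ a → w (suc a) (lookup v a))))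
        ≈⟨ ∑ₗ-cong (allFin N) (λ x → trans (∑ₗ-scale _ (tuples N l) _)
             (trans (*-congˡ (∑ₗ-chain δs (w ∘ suc) ⟦ x ⟧)) (*-assoc _ _ _))) ⟩
      ∑ₗ (allFin N) (λ x → ι (i <ᵇ ⟦ x ⟧ ℕ.+ δ) * (w zero x * nest δs (w ∘ suc) ⟦ x ⟧))
        ≡⟨ ∑ₗ-tabulate (λ x → x) (λ x → ι (i <ᵇ ⟦ x ⟧ ℕ.+ δ) * (w zero x * nest δs (w ∘ suc) ⟦ x ⟧)) ⟩
      nest (δ ∷ δs) w i ∎

    ∑ₗ-filter-chain : ∀ {p l} {P : Vec (Fin N) l → Set p} (P? : Decidable P) (δs : Vec ℕ l) i →
                      (∀ v → P v ⇔ Chain δs i v) → ∀ w →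
                      ∑ₗ (List.filter P? (tuples N l)) (λ v → ∏ₗ (allFin l) λ a → w a (lookup v a)) ≈ nest δs w i
    ∑ₗ-filter-chain {l = l} P? δs i P⇔chain w = begin
      ∑ₗ (List.filter P? (tuples N l)) (λ v → ∏ₗ (allFin l) λ a → w a (lookup v a))
        ≈⟨ ∑ₗ-filter P? (tuples N l) _ ⟩
      ∑ₗ (tuples N l) (λ v → ι (does (P? v)) * ∏ₗ (allFin l) λ a → w a (lookup v a))
        ≈⟨ ∑ₗ-cong (tuples N l) (λ v → *-congʳ (reflexive (≡.cong ι (does-⇔ (P⇔chain v) (P? v) (chain? δs i v))))) ⟩
      ∑ₗ (tuples N l) (λ v → ι (does (chain? δs i v)) * ∏ₗ (allFin l) λ a → w a (lookup v a))
        ≈⟨ ∑ₗ-chain δs w i ⟩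
      nest δs w i ∎

    duality : ∀ {l} (s : Vec ℕ l) → All (1 ≤_) s →
              ∑ₗ (increasing N l) (λ k → ∏ₗ (allFin l) λ a → harmonicWeight s a (lookup k a)) ≈
              (- 1#) ^ l * ∑ₗ (increasingStrictAt (partialSums s) N (Vec.sum s))
                              (λ j → ∏ₗ (allFin (Vec.sum s)) λ a → dualWeight a (lookup j a))
    duality {l} s s≥1 = begin
      ∑ₗ (increasing N l) (λ k → ∏ₗ (allFin l) λ a → harmonicWeight s a (lookup k a))
        ≈⟨ ∑ₗ-filter-chain (linked? Fin._<?_) (replicate l 0) 0 linked⇔chain (harmonicWeight s) ⟩
      nest (replicate l 0) (harmonicWeight s) 0
        ≈⟨ nest-duality s s≥1 ⟩
      (- 1#) ^ l * nest (slacks s) dualWeight 0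
        ≈⟨ *-congˡ (∑ₗ-filter-chain (increasingStrictAt? (partialSums s)) (slacks s) 0
             (increasingStrictAt⇔chain s s≥1) dualWeight) ⟨
      (- 1#) ^ l * ∑ₗ (increasingStrictAt (partialSums s) N (Vec.sum s))
                      (λ j → ∏ₗ (allFin (Vec.sum s)) λ a → dualWeight a (lookup j a)) ∎

-- From ℤ[q]/m to fractions

module ℤ[q]ᵣ = PolynomialRing ℤ.+-*-commutativeRing
module ℚ[q]ᵣ = PolynomialRing ℚ.+-*-commutativeRing

/1-+ : ∀ a b → (a ℤ.+ b) ℚ./ 1 ≡ (a ℚ./ 1) ℚ.+ (b ℚ./ 1)
/1-+ a b = ℚ.toℚᵘ-injective (begin
  toℚᵘ (fromℚᵘ (ℚᵘ.mkℚᵘ (a ℤ.+ b) 0))                   ≈⟨ ℚ.toℚᵘ-fromℚᵘ (ℚᵘ.mkℚᵘ (a ℤ.+ b) 0) ⟩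
  ℚᵘ.mkℚᵘ (a ℤ.+ b) 0
    ≡⟨ ≡.cong₂ (λ x y → ℚᵘ.mkℚᵘ (x ℤ.+ y) 0) (ℤ.*-identityʳ a) (ℤ.*-identityʳ b) ⟨
  ℚᵘ.mkℚᵘ a 0 ℚᵘ.+ ℚᵘ.mkℚᵘ b 0
    ≈⟨ ℚᵘ.+-cong (ℚ.toℚᵘ-fromℚᵘ (ℚᵘ.mkℚᵘ a 0)) (ℚ.toℚᵘ-fromℚᵘ (ℚᵘ.mkℚᵘ b 0)) ⟨
  toℚᵘ (a ℚ./ 1) ℚᵘ.+ toℚᵘ (b ℚ./ 1)                    ≈⟨ ℚ.toℚᵘ-homo-+ (a ℚ./ 1) (b ℚ./ 1) ⟨
  toℚᵘ ((a ℚ./ 1) ℚ.+ (b ℚ./ 1))                            ∎)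
  where open SetoidReasoning ℚᵘ.≃-setoid

/1-* : ∀ a b → (a ℤ.* b) ℚ./ 1 ≡ (a ℚ./ 1) ℚ.* (b ℚ./ 1)
/1-* a b = ℚ.toℚᵘ-injective (begin
  toℚᵘ (fromℚᵘ (ℚᵘ.mkℚᵘ (a ℤ.* b) 0))                   ≈⟨ ℚ.toℚᵘ-fromℚᵘ (ℚᵘ.mkℚᵘ (a ℤ.* b) 0) ⟩
  ℚᵘ.mkℚᵘ a 0 ℚᵘ.* ℚᵘ.mkℚᵘ b 0
    ≈⟨ ℚᵘ.*-cong (ℚ.toℚᵘ-fromℚᵘ (ℚᵘ.mkℚᵘ a 0)) (ℚ.toℚᵘ-fromℚᵘ (ℚᵘ.mkℚᵘ b 0)) ⟨
  toℚᵘ (a ℚ./ 1) ℚᵘ.* toℚᵘ (b ℚ./ 1)                    ≈⟨ ℚ.toℚᵘ-homo-* (a ℚ./ 1) (b ℚ./ 1) ⟨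
  toℚᵘ ((a ℚ./ 1) ℚ.* (b ℚ./ 1))                            ∎)
  where open SetoidReasoning ℚᵘ.≃-setoid

toℚ[q]-+ : ∀ f g → toℚ[q] (f ℤ[q].+ g) ≡ toℚ[q] f ℚ[q].+ toℚ[q] g
toℚ[q]-+ []      g       = ≡.refl
toℚ[q]-+ (a ∷ f) []      = ≡.refl
toℚ[q]-+ (a ∷ f) (b ∷ g) = ≡.cong₂ _∷_ (/1-+ a b) (toℚ[q]-+ f g)

toℚ[q]-· : ∀ a f → toℚ[q] (a ℤ[q]ᵣ.· f) ≡ (a ℚ./ 1) ℚ[q]ᵣ.· toℚ[q] f
toℚ[q]-· a []      = ≡.refl
toℚ[q]-· a (b ∷ f) = ≡.cong₂ _∷_ (/1-* a b) (toℚ[q]-· a f)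

toℚ[q]-* : ∀ f g → toℚ[q] (f ℤ[q].* g) ≡ toℚ[q] f ℚ[q].* toℚ[q] g
toℚ[q]-* []      g = ≡.refl
toℚ[q]-* (a ∷ f) g = ≡.trans (toℚ[q]-+ (a ℤ[q]ᵣ.· g) (0ℤ ∷ f ℤ[q].* g))
  (≡.cong₂ ℚ[q]._+_ (toℚ[q]-· a g) (≡.cong (ℚ.0ℚ ∷_) (toℚ[q]-* f g)))

coeff-toℚ[q] : ∀ f n → ℚ[q].coeff (toℚ[q] f) n ≡ ℤ[q].coeff f n ℚ./ 1
coeff-toℚ[q] []      n       = ≡.refl
coeff-toℚ[q] (a ∷ f) zero    = ≡.refl
coeff-toℚ[q] (a ∷ f) (suc n) = coeff-toℚ[q] f n

open ℤ[q]ᵣ using (coeffwise; _≋_)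
open ℤ[q]ᵣ._≋_ using (at)

toℚ[q]-cong : ∀ {f g} → f ≋ g → toℚ[q] f ℚ[q]ᵣ.≋ toℚ[q] g
toℚ[q]-cong {f} {g} f≋g = ℚ[q]ᵣ.coeffwise λ n →
  ≡.trans (coeff-toℚ[q] f n) (≡.trans (≡.cong (ℚ._/ 1) (at f≋g n)) (≡.sym (coeff-toℚ[q] g n)))

module CommonDivisor {c ℓ} (R : CommutativeRing c ℓ) where
  open CommutativeRing R
  open RingProperties ring using (-‿distribˡ-*)
  open SetoidReasoning setoid

  bezout-multiple : ∀ {x y u v a b z} → x * u ≈ 1# + v * y → a * z ≈ x → b * z ≈ y → (u * a - v * b) * z ≈ 1#
  bezout-multiple {x} {y} {u} {v} {a} {b} {z} xu≈1+vy az≈x bz≈y = begin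
    (u * a - v * b) * z           ≈⟨ distribʳ z (u * a) (- (v * b)) ⟩
    u * a * z + - (v * b) * z
      ≈⟨ +-cong (*-assoc u a z) (trans (sym (-‿distribˡ-* (v * b) z)) (-‿cong (*-assoc v b z))) ⟩
    u * (a * z) - v * (b * z)     ≈⟨ +-cong (*-congˡ az≈x) (-‿cong (*-congˡ bz≈y)) ⟩
    u * x - v * y                 ≈⟨ +-congʳ (trans (*-comm u x) xu≈1+vy) ⟩
    1# + v * y - v * y            ≈⟨ trans (+-assoc _ _ _) (trans (+-congˡ (-‿inverseʳ _)) (+-identityʳ 1#)) ⟩
    1#                            ∎

-- The Bézout identity is carried along ℤ[q] → ℚ[q], where it writes 1 as a multiple of any common
-- divisor.
bezout⇒coprime : ∀ {x y u v} → x ℤ[q].* u ≋ ℤ[q].1# ℤ[q].+ v ℤ[q].* y →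
                 ℚ[q].Coprime (toℚ[q] x) (toℚ[q] y)
bezout⇒coprime {x} {y} {u} {v} xu≋1+vy {z} (a ∣, az≈x) (b ∣, bz≈y) =
  (toℚ[q] u ℚ[q].* a ℚ[q].+ ℚ[q].- (toℚ[q] v ℚ[q].* b)) ∣, ℚ[q]ᵣ._≋_.at
    (bezout-multiple {x = toℚ[q] x} {y = toℚ[q] y} {u = toℚ[q] u} {v = toℚ[q] v} (begin
      toℚ[q] x ℚ[q].* toℚ[q] u                 ≡⟨ toℚ[q]-* x u ⟨
      toℚ[q] (x ℤ[q].* u)                      ≈⟨ toℚ[q]-cong xu≋1+vy ⟩
      toℚ[q] (ℤ[q].1# ℤ[q].+ v ℤ[q].* y)       ≡⟨ toℚ[q]-+ ℤ[q].1# (v ℤ[q].* y) ⟩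
      ℚ[q].1# ℚ[q].+ toℚ[q] (v ℤ[q].* y)       ≡⟨ ≡.cong (ℚ[q].1# ℚ[q].+_) (toℚ[q]-* v y) ⟩
      ℚ[q].1# ℚ[q].+ toℚ[q] v ℚ[q].* toℚ[q] y  ∎)
      (ℚ[q]ᵣ.coeffwise az≈x) (ℚ[q]ᵣ.coeffwise bz≈y))
  where
  open CommonDivisor ℚ[q]ᵣ.commutativeRing
  open SetoidReasoning (CommutativeRing.setoid ℚ[q]ᵣ.commutativeRing)

open import Defs
open import Data.Vec.Base using (sum)

-- Residue classes of fractions

module Modulo (m : ℤ[q]) where
  private
    module K = CommutativeRing (Quotient.commutativeRing ℤ[q]ᵣ.commutativeRing m)
    module E = Exp K.semiring
  open K using () renaming (Carrier to ℤ[q]/m; _≈_ to _≈ₘ_) public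
  open Quotient ℤ[q]ᵣ.commutativeRing m using (_∼_)
  open _∼_ using (quotient; equality)
  open RingProperties K.ring using (-‿distribˡ-*)
  open SemiringSolver K.commutativeSemiring using (solve; _:+_; _:*_; _:=_)
  open SetoidReasoning K.setoid

  -- The residue class of a fraction whose denominator is invertible modulo m.
  record _↦_ (A : ℚ⟨q⟩) (x : ℤ[q]/m) : Set where
    field
      den⁻¹   : ℤ[q]/m
      inverse : den A K.* den⁻¹ ≈ₘ K.1#
      value   : num A ≈ₘ x K.* den A

  open _↦_

  inverse-* : ∀ x y u v → x K.* u ≈ₘ K.1# → y K.* v ≈ₘ K.1# → (x K.* y) K.* (u K.* v) ≈ₘ K.1#
  inverse-* x y u v xu≈1 yv≈1 = begin
    (x K.* y) K.* (u K.* v)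
      ≈⟨ solve 4 (λ x y u v → (x :* y) :* (u :* v) := (x :* u) :* (y :* v)) K.refl x y u v ⟩
    (x K.* u) K.* (y K.* v)  ≈⟨ K.*-cong xu≈1 yv≈1 ⟩
    K.1# K.* K.1#            ≈⟨ K.*-identityˡ K.1# ⟩
    K.1#                     ∎

  ↦-+ : ∀ {A B x y} → A ↦ x → B ↦ y → (A + B) ↦ (x K.+ y)
  ↦-+ {A} {B} {x} {y} A↦x B↦y = record
    { den⁻¹ = den⁻¹ A↦x K.* den⁻¹ B↦y
    ; inverse = inverse-* (den A) (den B) (den⁻¹ A↦x) (den⁻¹ B↦y) (inverse A↦x) (inverse B↦y)
    ; value = begin
        num A K.* den B K.+ num B K.* den A
          ≈⟨ K.+-cong (K.*-congʳ (value A↦x)) (K.*-congʳ (value B↦y)) ⟩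
        (x K.* den A) K.* den B K.+ (y K.* den B) K.* den A
          ≈⟨ solve 4 (λ x y a b → (x :* a) :* b :+ (y :* b) :* a := (x :+ y) :* (a :* b))
               K.refl x y (den A) (den B) ⟩
        (x K.+ y) K.* (den A K.* den B) ∎
    }

  ↦-* : ∀ {A B x y} → A ↦ x → B ↦ y → (A * B) ↦ (x K.* y)
  ↦-* {A} {B} {x} {y} A↦x B↦y = record
    { den⁻¹ = den⁻¹ A↦x K.* den⁻¹ B↦y
    ; inverse = inverse-* (den A) (den B) (den⁻¹ A↦x) (den⁻¹ B↦y) (inverse A↦x) (inverse B↦y)
    ; value = begin
        num A K.* num B                    ≈⟨ K.*-cong (value A↦x) (value B↦y) ⟩
        (x K.* den A) K.* (y K.* den B)
          ≈⟨ solve 4 (λ x y a b → (x :* a) :* (y :* b) := (x :* y) :* (a :* b)) K.refl x y (den A) (den B) ⟩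
        (x K.* y) K.* (den A K.* den B)    ∎
    }

  ↦-neg : ∀ {A x} → A ↦ x → (- A) ↦ (K.- x)
  ↦-neg {A} {x} A↦x = record
    { den⁻¹ = den⁻¹ A↦x
    ; inverse = inverse A↦x
    ; value = K.trans (K.-‿cong (value A↦x)) (-‿distribˡ-* x (den A))
    }

  ↦-0 : 0# ↦ K.0#
  ↦-0 = record { den⁻¹ = K.1# ; inverse = K.*-identityˡ K.1# ; value = K.refl }

  ↦-1 : 1# ↦ K.1#
  ↦-1 = record { den⁻¹ = K.1# ; inverse = K.*-identityˡ K.1# ; value = K.sym (K.*-identityˡ K.1#) }

  ↦-^ : ∀ {A x} → A ↦ x → ∀ n → (A ^ n) ↦ (x E.^ n)
  ↦-^ A↦x zero    = ↦-1
  ↦-^ A↦x (suc n) = ↦-* A↦x (↦-^ A↦x n)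

  ↦-∑ : ∀ {a} {A : Set a} (xs : List A) {f : A → ℚ⟨q⟩} {g : A → ℤ[q]/m} → (∀ x → f x ↦ g x) →
        ∑ xs f ↦ List.foldr (λ x → g x K.+_) K.0# xs
  ↦-∑ []       f↦g = ↦-0
  ↦-∑ (x ∷ xs) f↦g = ↦-+ (f↦g x) (↦-∑ xs f↦g)

  ↦-∏ : ∀ {a} {A : Set a} (xs : List A) {f : A → ℚ⟨q⟩} {g : A → ℤ[q]/m} → (∀ x → f x ↦ g x) →
        ∏ xs f ↦ List.foldr (λ x → g x K.*_) K.1# xs
  ↦-∏ []       f↦g = ↦-1
  ↦-∏ (x ∷ xs) f↦g = ↦-* (f↦g x) (↦-∏ xs f↦g)

  ^≡^ : ∀ f n → f ℤ[q].^ n ≡ f E.^ n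
  ^≡^ f zero    = ≡.refl
  ^≡^ f (suc n) = ≡.cong (f ℤ[q].*_) (^≡^ f n)

  inverse-^ : ∀ x u → x K.* u ≈ₘ K.1# → ∀ n → (x E.^ n) K.* (u E.^ n) ≈ₘ K.1#
  inverse-^ x u xu≈1 zero    = K.*-identityˡ K.1#
  inverse-^ x u xu≈1 (suc n) = inverse-* x (x E.^ n) u (u E.^ n) xu≈1 (inverse-^ x u xu≈1 n)

  ↦-q^/[]^ : ∀ a {n} (k : Fin n) b {u} → [ ⟦ k ⟧ ]q K.* u ≈ₘ K.1# → (q^ a /[ k ]^ b) ↦ ((q E.^ a) K.* (u E.^ b))
  ↦-q^/[]^ a k b {u} ku≈1 = record
    { den⁻¹ = u E.^ b
    ; inverse = K.trans (K.*-congʳ {u E.^ b} (K.reflexive (^≡^ [ ⟦ k ⟧ ]q b))) (inverse-^ [ ⟦ k ⟧ ]q u ku≈1 b)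
    ; value = begin
        q ℤ[q].^ a                                               ≡⟨ ^≡^ q a ⟩
        q E.^ a                                                  ≈⟨ K.*-identityʳ _ ⟨
        (q E.^ a) K.* K.1#
          ≈⟨ K.*-congˡ {q E.^ a} (inverse-^ [ ⟦ k ⟧ ]q u ku≈1 b) ⟨
        (q E.^ a) K.* (([ ⟦ k ⟧ ]q E.^ b) K.* (u E.^ b))
          ≈⟨ solve 3 (λ s t r → s :* (t :* r) := (s :* r) :* t)
               K.refl (q E.^ a) ([ ⟦ k ⟧ ]q E.^ b) (u E.^ b) ⟩
        ((q E.^ a) K.* (u E.^ b)) K.* ([ ⟦ k ⟧ ]q E.^ b)
          ≡⟨ ≡.cong (((q E.^ a) K.* (u E.^ b)) K.*_) (^≡^ [ ⟦ k ⟧ ]q b) ⟨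
        ((q E.^ a) K.* (u E.^ b)) K.* ([ ⟦ k ⟧ ]q ℤ[q].^ b)      ∎
    }

  -- The unreduced fraction A - B is itself the required witness: invertibility of its denominator
  -- modulo m is a Bézout identity, and its numerator is congruent to 0.
  ↦⇒≡mod : ∀ {A B x y} → A ↦ x → B ↦ y → x ≈ₘ y → A ≡ B [mod m ]
  ↦⇒≡mod {A} {B} {x} {y} A↦x B↦y x≈y =
    A + - B , (λ n → ≡.refl) ,
    bezout⇒coprime {x = den (A + - B)} {u = den⁻¹ A-B↦} {v = quotient (inverse A-B↦)}
      (equality (inverse A-B↦)) ,
    (quotient num≈0 ∣, λ n → ≡.sym (at (equality num≈0) n))
    where
    A-B↦ : (A + - B) ↦ (x K.+ K.- y)
    A-B↦ = ↦-+ A↦x (↦-neg B↦y)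
    num≈0 : num (A + - B) ≈ₘ K.0#
    num≈0 = begin
      num (A + - B)                          ≈⟨ value A-B↦ ⟩
      (x K.+ K.- y) K.* den (A + - B)        ≈⟨ K.*-congʳ (K.trans (K.+-congʳ x≈y) (K.-‿inverseʳ y)) ⟩
      K.0# K.* den (A + - B)                 ≈⟨ K.zeroˡ (den (A + - B)) ⟩
      K.0#                                   ∎

theorem8p2 : (p : ℕ) → Prime p → (l : ℕ) → 1 ≤ l →
    (s : Vec ℕ l) → All (1 ≤_) s →
    H (p ∸ 1) s ≡
    (- 1#) ^ l * (∑[ j ∈ increasingStrictAt (partialSums s) (p ∸ 1) (sum s) ]
    ∏[ i ∈ allFin (sum s) ] q^ ⟦ lookup j i ⟧ /[ lookup j i ]^ 1)
    [mod [ p ]q ]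
theorem8p2 zero    p-prime l l≥1 s s≥1 = contradiction p-prime ¬prime[0]
theorem8p2 (suc N) p-prime l l≥1 s s≥1 = ↦⇒≡mod
  (↦-∑ (increasing N l) λ k → ↦-∏ (allFin l) λ i →
    ↦-q^/[]^ ((lookup s i ∸ 1) ℕ.* ⟦ lookup k i ⟧) (lookup k i) (lookup s i) (k-inverse (lookup k i)))
  (↦-* (↦-^ (↦-neg ↦-1) l)
    (↦-∑ (increasingStrictAt (partialSums s) N (sum s)) λ j → ↦-∏ (allFin (sum s)) λ i →
      ↦-q^/[]^ ⟦ lookup j i ⟧ (lookup j i) 1 (k-inverse (lookup j i))))
  (Duality.duality N (λ k → proj₁ (invertible k)) (λ k → proj₂ (invertible k)) ⟨p⟩≈0 s s≥1)
  where
  open Modulo [ suc N ]q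
  open Quotient ℤ[q]ᵣ.commutativeRing [ suc N ]q using (commutativeRing; ≈⇒∼; m∼0)
  open QAnalogue commutativeRing q
  module K = CommutativeRing commutativeRing

  []≈⟨⟩ : ∀ n → [ n ]q ≈ₘ ⟨ n ⟩
  []≈⟨⟩ zero    = K.refl
  []≈⟨⟩ (suc n) = K.trans (K.sym (≈⇒∼ (ℤ[q]ᵣ.1+X* [ n ]q))) (K.+-congˡ {ℤ[q].1#} (K.*-congˡ {q} ([]≈⟨⟩ n)))

  ⟨p⟩≈0 : ⟨ suc N ⟩ ≈ₘ K.0#
  ⟨p⟩≈0 = K.trans (K.sym ([]≈⟨⟩ (suc N))) m∼0

  invertible : ∀ (k : Fin N) → ∃ λ a → ⟨ ⟦ k ⟧ ⟩ K.* a ≈ₘ K.1#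
  invertible k = ⟨⟩-invertible p-prime (s≤s (Fin.toℕ<n k)) ⟨p⟩≈0

  k-inverse : ∀ (k : Fin N) → [ ⟦ k ⟧ ]q K.* proj₁ (invertible k) ≈ₘ K.1#
  k-inverse k = K.trans (K.*-congʳ ([]≈⟨⟩ ⟦ k ⟧)) (proj₂ (invertible k))
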